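{- For any origin-symmetric convex polytope $P$ we have $$\log\mathrm{rk}^+_{2\varepsilon}(S_P)\ \le\ \mathcal{R}_{\varepsilon,\varepsilon}(\mathrm{IP}_P)\ \le\ O\bigl(\log(\varepsilon^{ -1})\,\mathcal{R}_{\varepsilon,1/3}(\mathrm{IP}_P)\bigr).$$
   Context: A polytope $P\subset\mathbb{R}^n$ is origin-symmetric if $P=-P$. The associated norm is $\|w\|_P=\inf\{\lambda:w/\lambda\in P\}$, the unique norm for which $P$ is the unit ball, and $\mathrm{IP}_P$ means $\mathrm{IP}_N$ for $N=\|\cdot\|_P$. For a convex polytope specified by a matrix $A\in\mathbb{R}^{M\times n}$ with rows $A_i$ via $P=\{v:\forall i\le M,\ \langle A_i,v\rangle\le b_i\}$, the slack matrix $S_P$ is the non-negative matrix with rows indexed by the vertices $v$ of $P$ and columns indexed by $i\le M$, with entries $(S_P)_{v,i}=b_i-\langle A_i,v\rangle$. The non-negative rank $\mathrm{rk}^+(S)$ of a matrix $S$ is the smallest $r$ such that $S=\sum_{j\le r}a_jc_j^T$ with coordinatewise non-negative vectors $a_j,c_j$. For a non-negative matrix $S$ and $\eta\ge0$, the approximate non-negative rank $\mathrm{rk}^+_{\eta}(S)$ is the infimum of $\mathrm{rk}^+(S')$ over matrices $S'$ with $|S_{ij}-S'_{ij}|\le\eta$ for all $i,j$. For a norm $N$ on $\mathbb{R}^n$ the dual norm is $\|w\|_{N^*}=\sup_{\|v\|_N\le 1}\langle v,w\rangle$. In the communication problem $\mathrm{IP}_N$, Alice holds $v\in\mathbb{R}^n$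 with $\|v\|_N\le1$ and Bob holds $w\in\mathbb{R}^n$ with $\|w\|_{N^*}\le1$, and they wish to approximate $\langle v,w\rangle$. $\mathcal{R}_{\varepsilon,\delta}(\mathrm{IP}_N)$ is the smallest communication cost (in bits) of a randomized private-coin protocol (interaction in both directions allowed) whose output is, for all valid inputs $(v,w)$, within additive error $\varepsilon$ of $\langle v,w\rangle$ with probability at least $1-\delta$.
   Formalization: The first inequality assumes P's inequalities are normalised so that all b_i ≤ 1 (it fails for arbitrarily rescaled descriptions); the O-bound is for 0 < ε ≤ ε₀ with any fixed ε₀ < 1, its constant depending only on ε₀ (no single constant works as ε → 1). -}

module Defs where

open import Algebra.Bundles using (CommutativeRing; Semiring)
open import Axiom.ExcludedMiddle using (ExcludedMiddle)
open import Data.Fin.Base using (Fin)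
import Data.Maybe.Base as Maybe
open import Data.Nat.Base as ℕ using (ℕ; zero; suc)
open import Data.Product.Base using (Σ; ∃; ∃-syntax; _×_; _,_; proj₁)
open import Data.Sum.Base using (inj₁; inj₂)
open import Data.Vec.Functional using (Vector)
open import Level using (0ℓ)
open import Relation.Binary.Core using (Rel)
open import Relation.Binary.PropositionalEquality.Core using (_≡_)
open import Relation.Binary.Structures using (IsTotalOrder)
open import Relation.Nullary.Construct.Add.Supremum using (_⁺; [_]; ⊤⁺)
import Relation.Binary.Construct.Add.Supremum.NonStrict as AddSup
open import Relation.Nullary.Decidable.Core using (yes; no)
open import Relation.Nullary.Negation.Core using (¬_)
import Algebra.Definitions.RawSemiring as RawSemiringDefs

IsUpperBound IsLUB : {X : Set} → Rel X 0ℓ → (X → Set) → X → Set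
IsUpperBound _≤_ S u = ∀ x → S x → x ≤ u
IsLUB _≤_ S s = IsUpperBound _≤_ S s × (∀ u → IsUpperBound _≤_ S u → s ≤ u)

-- The real numbers are treated axiomatically: together with excluded middle,
-- the fields below determine ℝ up to a unique isomorphism.
record CompleteOrderedField : Set₁ where
  infix 4 _≤_ _<_
  infix 8 _⁻¹
  field
    commutativeRing : CommutativeRing 0ℓ 0ℓ
  open CommutativeRing commutativeRing public
  field
    _≤_          : Rel Carrier 0ℓ
    isTotalOrder : IsTotalOrder _≈_ _≤_
    0≉1          : ¬ (0# ≈ 1#)
    -- The value of 0# ⁻¹ is unspecified.
    _⁻¹          : Carrier → Carrier
    ⁻¹-inverseʳ  : ∀ {x} → ¬ (x ≈ 0#) → x * x ⁻¹ ≈ 1#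
    +-monoˡ-≤    : ∀ {x y} z → x ≤ y → x + z ≤ y + z
    *-nonNeg     : ∀ {x y} → 0# ≤ x → 0# ≤ y → 0# ≤ x * y
    complete     : (S : Carrier → Set) → ∃ S → ∃ (IsUpperBound _≤_ S) →
                   ∃ (IsLUB _≤_ S)

  _<_ : Rel Carrier 0ℓ
  x < y = ¬ (y ≤ x)

  open IsTotalOrder isTotalOrder public using (total)

  ∣_∣ : Carrier → Carrier
  ∣ x ∣ with total 0# x
  ... | inj₁ _ = x
  ... | inj₂ _ = - x

  open RawSemiringDefs (Semiring.rawSemiring semiring) public
    using (sum; _^_) renaming (_×_ to _·_)

  fromℕ : ℕ → Carrier
  fromℕ k = k · 1#

module Theory (lem : ExcludedMiddle 0ℓ) (𝓡 : CompleteOrderedField) where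

  open CompleteOrderedField 𝓡 public
  open AddSup _≤_ public using (_≤⁺_)

  ℝ : Set
  ℝ = Carrier

  -- By convention sup S = 0# when S is empty or unbounded above.
  sup : (ℝ → Set) → ℝ
  sup S with lem {∃ (IsLUB _≤_ S)}
  ... | yes (s , _) = s
  ... | no _        = 0#

  inf : (ℝ → Set) → ℝ
  inf S = - sup (λ x → S (- x))

  -- The smallest natural number with the property Q, and ⊤⁺ (that is, +∞)
  -- when there is none.
  least : (ℕ → Set) → ℕ ⁺
  least Q with lem {∃[ k ] (Q k × (∀ l → Q l → k ℕ.≤ l))}
  ... | yes (k , _) = [ k ]
  ... | no _        = ⊤⁺

  -- log₂ x is the supremum of the rationals y = (m - k) / (suc d) satisfying
  -- 2 ^ y ≤ x.  The convention for sup makes log₂ 0# equal to 0#; where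
  -- log₂ 0# occurs as a lower bound this is stronger than using -∞.
  log₂ : ℝ → ℝ
  log₂ x = sup λ y → ∃[ m ] ∃[ k ] ∃[ d ]
    (y * fromℕ (suc d) + fromℕ k ≈ fromℕ m) ×
    (fromℕ 2 ^ m ≤ fromℕ 2 ^ k * x ^ suc d)

  log₂⁺ : ℕ ⁺ → ℝ ⁺
  log₂⁺ = Maybe.map λ k → log₂ (fromℕ k)

  fromℕ⁺ : ℕ ⁺ → ℝ ⁺
  fromℕ⁺ = Maybe.map fromℕ

  -- Multiplication by a positive real, so that x *⁺ ⊤⁺ = ⊤⁺.
  infixl 7 _*⁺_
  _*⁺_ : ℝ → ℝ ⁺ → ℝ ⁺
  x *⁺ y = Maybe.map (x *_) y

  ----------------------------------------------------------------------
  -- Vectors and norms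

  ℝ^ : ℕ → Set
  ℝ^ n = Vector ℝ n

  infix 4 _≋_
  _≋_ : ∀ {n} → ℝ^ n → ℝ^ n → Set
  v ≋ w = ∀ i → v i ≈ w i

  ⟨_,_⟩ : ∀ {n} → ℝ^ n → ℝ^ n → ℝ
  ⟨ v , w ⟩ = sum λ i → v i * w i

  neg : ∀ {n} → ℝ^ n → ℝ^ n
  neg v i = - v i

  infixl 7 _⊘_
  _⊘_ : ∀ {n} → ℝ^ n → ℝ → ℝ^ n
  (w ⊘ c) i = w i * c ⁻¹

  dual : ∀ {n} → (ℝ^ n → ℝ) → (ℝ^ n → ℝ)
  dual N w = sup λ x → ∃[ v ] (N v ≤ 1#) × (x ≈ ⟨ v , w ⟩)

  ----------------------------------------------------------------------
  -- Polytopes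

  -- A description of an origin-symmetric polytope by M inequalities.  The
  -- field `interior` (full-dimensionality) is what makes P the unit ball of
  -- a norm.
  record SymmetricPolytope (n M : ℕ) : Set where
    field
      A : Fin M → ℝ^ n
      b : Fin M → ℝ

    _∈P : ℝ^ n → Set
    v ∈P = ∀ i → ⟨ A i , v ⟩ ≤ b i

    field
      bounded   : ∃[ B ] (∀ v → v ∈P → ∀ i → ∣ v i ∣ ≤ B)
      symmetric : ∀ v → v ∈P → neg v ∈P
      interior  : ∃[ r ] (0# < r) × (∀ v → (∀ i → ∣ v i ∣ ≤ r) → v ∈P)

    -- Vertices are the zero-dimensional faces: the points that are the unique
    -- maximiser over P of some linear functional.
    IsVertex : ℝ^ n → Set
    IsVertex v = (v ∈P) × (∃[ c ] (∀ x → x ∈P →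
      (⟨ c , x ⟩ ≤ ⟨ c , v ⟩) × (⟨ c , x ⟩ ≈ ⟨ c , v ⟩ → x ≋ v)))

    Vertex : Set
    Vertex = Σ (ℝ^ n) IsVertex

    slack : Vertex → Fin M → ℝ
    slack (v , _) i = b i - ⟨ A i , v ⟩

    norm : ℝ^ n → ℝ
    norm w = inf λ c → (0# < c) × ((w ⊘ c) ∈P)

  open SymmetricPolytope public using (b; slack; norm)

  ----------------------------------------------------------------------
  -- Non-negative rank, for matrices with arbitrary index types

  HasNonnegFactorization : {I J : Set} → (I → J → ℝ) → ℕ → Set
  HasNonnegFactorization {I} {J} S r =
    Σ (Fin r → I → ℝ) λ a → Σ (Fin r → J → ℝ) λ c →
      (∀ k i → 0# ≤ a k i) × (∀ k j → 0# ≤ c k j) ×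
      (∀ i j → S i j ≈ sum λ k → a k i * c k j)

  rk⁺ : {I J : Set} → (I → J → ℝ) → ℕ ⁺
  rk⁺ S = least (HasNonnegFactorization S)

  approxRk⁺ : {I J : Set} → ℝ → (I → J → ℝ) → ℕ ⁺
  approxRk⁺ {I} {J} η S = least λ r →
    Σ (I → J → ℝ) λ S′ → (∀ i j → ∣ S i j - S′ i j ∣ ≤ η) × (rk⁺ S′ ≡ [ r ])

  ----------------------------------------------------------------------
  -- Private-coin protocols

  -- The probability of sending the bit 1, as a function of the sender's input.
  record Coin (n : ℕ) : Set where
    field
      bias     : ℝ^ n → ℝ
      cong     : ∀ {v w} → v ≋ w → bias v ≈ bias w
      nonneg   : ∀ v → 0# ≤ bias v
      at-most1 : ∀ v → bias v ≤ 1#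

  -- A protocol tree.  At an inner node its owner sends one random bit, whose
  -- conditional distribution given the transcript so far (the node) depends
  -- only on the owner's input; this is the general form of a protocol in which
  -- each party has its own private random string.  The first subtree is
  -- entered on bit 1.  The output is determined by the transcript (the leaf).
  data Protocol (n : ℕ) : Set where
    output : ℝ → Protocol n
    alice  : Coin n → Protocol n → Protocol n → Protocol n
    bob    : Coin n → Protocol n → Protocol n → Protocol n

  cost : ∀ {n} → Protocol n → ℕ
  cost (output _)    = 0
  cost (alice _ π ρ) = suc (cost π ℕ.⊔ cost ρ)
  cost (bob _ π ρ)   = suc (cost π ℕ.⊔ cost ρ)

  -- The probability that the output on input (v , w) satisfies E.
  Pr : ∀ {n} → Protocol n → ℝ^ n → ℝ^ n → (ℝ → Set) → ℝ
  Pr (output o) v w E with lem {E o}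
  ... | yes _ = 1#
  ... | no _  = 0#
  Pr (alice p π ρ) v w E =
    Coin.bias p v * Pr π v w E + (1# - Coin.bias p v) * Pr ρ v w E
  Pr (bob p π ρ) v w E =
    Coin.bias p w * Pr π v w E + (1# - Coin.bias p w) * Pr ρ v w E

  SolvesIP : ∀ {n} → (ℝ^ n → ℝ) → ℝ → ℝ → Protocol n → Set
  SolvesIP N ε δ π = ∀ v w → N v ≤ 1# → dual N w ≤ 1# →
    1# - δ ≤ Pr π v w (λ o → ∣ o - ⟨ v , w ⟩ ∣ ≤ ε)

  -- 𝓒 N ε δ is the randomized communication complexity of IP_N with additive
  -- error ε and failure probability δ.
  𝓒 : ∀ {n} → (ℝ^ n → ℝ) → ℝ → ℝ → ℕ ⁺
  𝓒 {n} N ε δ = least λ c → ∃[ π ] (cost {n} π ≡ c) × SolvesIP N ε δ π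

-- For the lower bound, the leaves of a protocol of cost c give a non-negative
-- factorization with at most 2 ^ c terms of every matrix that, like an expected
-- (decoded) output, is an average of leaf values weighted by the leaf
-- probabilities.  A vertex v has norm at most 1 and a row A i has dual norm at
-- most 1, so the protocol applies to them.  Its output o is decoded as o / (1 - ε)
-- clamped to [- b i, b i]: the slack b i minus the decoded output is
-- non-negative, and its expectation is within 2 ε of the slack matrix.
-- (For ε ≥ 1 the zero matrix is close enough.)
--
-- For the upper bound, the protocol with failure probability 1 / 3 is run 2 s
-- times, and the output is a point near more than half of the results.  By the
-- exponential moment method this fails with probability at most (8 / 9) ^ s, so
-- s = O(log (1 / ε)) suffices.

module Submission where

open import Axiom.ExcludedMiddle using (ExcludedMiddle)
open import Data.Nat.Base using (ℕ)
open import Data.Product.Base using (_×_; ∃-syntax)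
open import Level using (0ℓ)
open import Defs

import Algebra.Solver.Ring as RingSolver
open import Algebra.Solver.Ring.AlmostCommutativeRing
  using (fromCommutativeRing; _-Raw-AlmostCommutative⟶_)
import Algebra.Properties.Ring as RingProperties
import Algebra.Properties.CommutativeSemiring.Exp as CommutativeExp
import Algebra.Properties.Semiring.Exp as Exp
import Algebra.Properties.Semiring.Mult as Mult
import Algebra.Properties.Semiring.Sum as Sum
open import Data.Fin.Base using (Fin; zero; suc; splitAt)
open import Data.Integer.Base as ℤ using (ℤ; +_; -[1+_])
import Data.Integer.Properties as ℤ
open import Data.Maybe.Base using (just; nothing)
open import Data.Nat.Base as ℕ using (zero; suc; z≤n; s≤s)
import Data.Nat.Properties as ℕ
open import Data.Product.Base using (∃; Σ; _,_; proj₁; proj₂)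
open import Data.Sum.Base using (_⊎_; inj₁; inj₂; [_,_]′)
open import Data.Vec.Base using (Vec; []; _∷_)
open import Data.Vec.Functional using (Vector; _++_)
open import Relation.Binary.Bundles using (Poset)
open import Relation.Binary.Definitions using (WeaklyDecidable)
open import Relation.Binary.PropositionalEquality as ≡ using (_≡_)
import Relation.Binary.Reasoning.PartialOrder as PosetReasoning
import Relation.Binary.Construct.Add.Supremum.NonStrict as Sup
open import Relation.Binary.Structures using (IsTotalOrder)
open import Relation.Nullary.Construct.Add.Supremum using ([_]; ⊤⁺)
open import Relation.Nullary.Decidable.Core using (yes; no)
open import Relation.Nullary.Negation.Core using (¬_; contradiction)

-- Arithmetic in ordered fields.

module OrderedFieldProperties (𝓡 : CompleteOrderedField) where

  open CompleteOrderedField 𝓡 hiding (zero)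
  open IsTotalOrder isTotalOrder public
    using (isPartialOrder; antisym)
    renaming (refl to ≤-refl; trans to ≤-trans; reflexive to ≤-reflexive)
  open RingProperties ring public using (-‿involutive; -‿+-comm; -0#≈0#)
  open Exp semiring public using (^-homo-*; ^-assocʳ; ^-congˡ)
  open CommutativeExp commutativeSemiring public using (^-distrib-*)
  open Sum semiring public using (sum-cong-≋; *-distribʳ-sum; *-distribˡ-sum)
  open Mult semiring public using (×-homo-+; ×1-homo-*)

  poset : Poset _ _ _
  poset = record { isPartialOrder = isPartialOrder }

  open PosetReasoning poset

  -- The ring homomorphism from the integers, which provides the coefficients of the ring solver.

  private
    ⟦_⟧ : ℤ → Carrier
    ⟦ + n ⟧      = fromℕ n
    ⟦ -[1+ n ] ⟧ = - fromℕ (suc n)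

    -‿homo : ∀ i → ⟦ ℤ.- i ⟧ ≈ - ⟦ i ⟧
    -‿homo (+ zero)   = sym -0#≈0#
    -‿homo (+ suc n)  = refl
    -‿homo (-[1+ n ]) = sym (-‿involutive _)

    ⊖-homo : ∀ m n → ⟦ m ℤ.⊖ n ⟧ ≈ fromℕ m - fromℕ n
    ⊖-homo m       zero    = sym (trans (+-congˡ -0#≈0#) (+-identityʳ _))
    ⊖-homo zero    (suc n) = sym (+-identityˡ _)
    ⊖-homo (suc m) (suc n) = begin-equality
      ⟦ suc m ℤ.⊖ suc n ⟧                  ≡⟨ ≡.cong ⟦_⟧ (ℤ.[1+m]⊖[1+n]≡m⊖n m n) ⟩
      ⟦ m ℤ.⊖ n ⟧                          ≈⟨ ⊖-homo m n ⟩
      fromℕ m - fromℕ n                    ≈⟨ +-congʳ (+-identityʳ _) ⟨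
      fromℕ m + 0# - fromℕ n               ≈⟨ +-congʳ (+-congˡ (-‿inverseʳ 1#)) ⟨
      fromℕ m + (1# - 1#) - fromℕ n        ≈⟨ +-congʳ (+-assoc _ _ _) ⟨
      fromℕ m + 1# - 1# - fromℕ n          ≈⟨ +-assoc _ _ _ ⟩
      fromℕ m + 1# + (- 1# - fromℕ n)      ≈⟨ +-cong (+-comm _ _) (-‿+-comm _ _) ⟩
      fromℕ (suc m) - fromℕ (suc n)        ∎

    +-homo : ∀ i j → ⟦ i ℤ.+ j ⟧ ≈ ⟦ i ⟧ + ⟦ j ⟧
    +-homo (+ m)      (+ n)      = ×-homo-+ 1# m n
    +-homo (+ m)      -[1+ n ]   = ⊖-homo m (suc n)
    +-homo (-[1+ m ]) (+ n)      = trans (⊖-homo n (suc m)) (+-comm _ _)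
    +-homo (-[1+ m ]) (-[1+ n ]) = begin-equality
      - fromℕ (suc (suc (m ℕ.+ n)))        ≡⟨ ≡.cong (λ k → - fromℕ (suc k)) (ℕ.+-suc m n) ⟨
      - fromℕ (suc m ℕ.+ suc n)            ≈⟨ -‿cong (×-homo-+ 1# (suc m) (suc n)) ⟩
      - (fromℕ (suc m) + fromℕ (suc n))    ≈⟨ -‿+-comm _ _ ⟨
      - fromℕ (suc m) - fromℕ (suc n)      ∎

    *-homo⁺ : ∀ m j → ⟦ + m ℤ.* j ⟧ ≈ fromℕ m * ⟦ j ⟧
    *-homo⁺ m (+ n) = begin-equality
      ⟦ + m ℤ.* + n ⟧     ≡⟨ ≡.cong ⟦_⟧ (ℤ.pos-* m n) ⟨
      fromℕ (m ℕ.* n)     ≈⟨ ×1-homo-* m n ⟩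
      fromℕ m * fromℕ n   ∎
    *-homo⁺ m -[1+ n ] = begin-equality
      ⟦ + m ℤ.* -[1+ n ] ⟧         ≡⟨ ≡.cong ⟦_⟧ (ℤ.neg-distribʳ-* (+ m) (+ suc n)) ⟨
      ⟦ ℤ.- (+ m ℤ.* + suc n) ⟧    ≈⟨ -‿homo (+ m ℤ.* + suc n) ⟩
      - ⟦ + m ℤ.* + suc n ⟧        ≈⟨ -‿cong (*-homo⁺ m (+ suc n)) ⟩
      - (fromℕ m * fromℕ (suc n))  ≈⟨ RingProperties.-‿distribʳ-* ring _ _ ⟩
      fromℕ m * - fromℕ (suc n)    ∎

    *-homo : ∀ i j → ⟦ i ℤ.* j ⟧ ≈ ⟦ i ⟧ * ⟦ j ⟧
    *-homo (+ m)    j = *-homo⁺ m j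
    *-homo -[1+ m ] j = begin-equality
      ⟦ -[1+ m ] ℤ.* j ⟧         ≡⟨ ≡.cong ⟦_⟧ (ℤ.neg-distribˡ-* (+ suc m) j) ⟨
      ⟦ ℤ.- (+ suc m ℤ.* j) ⟧    ≈⟨ -‿homo (+ suc m ℤ.* j) ⟩
      - ⟦ + suc m ℤ.* j ⟧        ≈⟨ -‿cong (*-homo⁺ (suc m) j) ⟩
      - (fromℕ (suc m) * ⟦ j ⟧)  ≈⟨ RingProperties.-‿distribˡ-* ring _ _ ⟩
      - fromℕ (suc m) * ⟦ j ⟧    ∎

    -- Unlike ⟦_⟧, this sends + 1 to 1# itself and not to 1# + 0#, so that the
    -- constants of solver expressions unfold to 0#, 1#, fromℕ 2, fromℕ 3, ….
    ⟦_⟧₁ : ℤ → Carrier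
    ⟦ + 1 ⟧₁ = 1#
    ⟦ i ⟧₁   = ⟦ i ⟧

    ⟦⟧₁≈⟦⟧ : ∀ i → ⟦ i ⟧₁ ≈ ⟦ i ⟧
    ⟦⟧₁≈⟦⟧ (+ zero)        = refl
    ⟦⟧₁≈⟦⟧ (+ 1)           = sym (+-identityʳ 1#)
    ⟦⟧₁≈⟦⟧ (+ suc (suc n)) = refl
    ⟦⟧₁≈⟦⟧ -[1+ n ]        = refl

    morphism : ℤ.+-*-rawRing -Raw-AlmostCommutative⟶ fromCommutativeRing commutativeRing
    morphism = record
      { ⟦_⟧    = ⟦_⟧₁
      ; +-homo = λ i j → transfer (i ℤ.+ j) (+-homo i j) (+-cong (⟦⟧₁≈⟦⟧ i) (⟦⟧₁≈⟦⟧ j))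
      ; *-homo = λ i j → transfer (i ℤ.* j) (*-homo i j) (*-cong (⟦⟧₁≈⟦⟧ i) (⟦⟧₁≈⟦⟧ j))
      ; -‿homo = λ i → transfer (ℤ.- i) (-‿homo i) (-‿cong (⟦⟧₁≈⟦⟧ i))
      ; 0-homo = refl
      ; 1-homo = refl
      }
      where
      transfer : ∀ k {x y} → ⟦ k ⟧ ≈ x → y ≈ x → ⟦ k ⟧₁ ≈ y
      transfer k p q = trans (⟦⟧₁≈⟦⟧ k) (trans p (sym q))

    _≟_ : WeaklyDecidable (λ i j → ⟦ i ⟧₁ ≈ ⟦ j ⟧₁)
    i ≟ j with i ℤ.≟ j
    ... | yes ≡.refl = just refl
    ... | no _       = nothing

  open RingSolver ℤ.+-*-rawRing (fromCommutativeRing commutativeRing) morphism _≟_ public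
    using (solve; con; _:+_; _:*_; _:-_; :-_; _:=_)

  -- Inequalities, inverses, natural multiples, powers and absolute values.

  ≤⇒0≤ : ∀ {x y} → x ≤ y → 0# ≤ y - x
  ≤⇒0≤ {x} {y} x≤y = begin
    0#     ≈⟨ -‿inverseʳ x ⟨
    x - x  ≤⟨ +-monoˡ-≤ (- x) x≤y ⟩
    y - x  ∎

  0≤⇒≤ : ∀ {x y} → 0# ≤ y - x → x ≤ y
  0≤⇒≤ {x} {y} 0≤y-x = begin
    x          ≈⟨ +-identityˡ x ⟨
    0# + x     ≤⟨ +-monoˡ-≤ x 0≤y-x ⟩
    y - x + x  ≈⟨ solve 2 (λ x y → y :- x :+ x := y) refl x y ⟩
    y          ∎

  -- Linear arithmetic is done by passing as d a non-negative combination of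
  -- hypotheses and leaving the equation to the ring solver.
  ≤-by : ∀ {x y d} → 0# ≤ d → d ≈ y - x → x ≤ y
  ≤-by 0≤d d≈ = 0≤⇒≤ (≤-trans 0≤d (≤-reflexive d≈))

  ≰⇒≥ : ∀ {x y} → ¬ (x ≤ y) → y ≤ x
  ≰⇒≥ {x} {y} x≰y with total x y
  ... | inj₁ x≤y = contradiction x≤y x≰y
  ... | inj₂ y≤x = y≤x

  +-mono-≤ : ∀ {x y u v} → x ≤ y → u ≤ v → x + u ≤ y + v
  +-mono-≤ {x} {y} {u} {v} x≤y u≤v = begin
    x + u  ≤⟨ +-monoˡ-≤ u x≤y ⟩
    y + u  ≈⟨ +-comm y u ⟩
    u + y  ≤⟨ +-monoˡ-≤ y u≤v ⟩
    v + y  ≈⟨ +-comm v y ⟩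
    y + v  ∎

  +-nonNeg : ∀ {x y} → 0# ≤ x → 0# ≤ y → 0# ≤ x + y
  +-nonNeg 0≤x 0≤y = ≤-trans (≤-reflexive (sym (+-identityˡ 0#))) (+-mono-≤ 0≤x 0≤y)

  neg-mono : ∀ {x y} → x ≤ y → - y ≤ - x
  neg-mono {x} {y} x≤y =
    ≤-by (≤⇒0≤ x≤y) (solve 2 (λ x y → y :- x := :- x :- :- y) refl x y)

  *-monoˡ-≤ : ∀ {x y z} → 0# ≤ z → x ≤ y → z * x ≤ z * y
  *-monoˡ-≤ {x} {y} {z} 0≤z x≤y =
    ≤-by (*-nonNeg 0≤z (≤⇒0≤ x≤y)) (solve 3 (λ x y z → z :* (y :- x) := z :* y :- z :* x) refl x y z)

  *-mono-≤ : ∀ {x y u v} → 0# ≤ y → 0# ≤ u → x ≤ y → u ≤ v → x * u ≤ y * v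
  *-mono-≤ {x} {y} {u} {v} 0≤y 0≤u x≤y u≤v =
    ≤-by (+-nonNeg (*-nonNeg 0≤u (≤⇒0≤ x≤y)) (*-nonNeg 0≤y (≤⇒0≤ u≤v)))
      (solve 4 (λ x y u v → u :* (y :- x) :+ y :* (v :- u) := y :* v :- x :* u) refl x y u v)

  0≤1 : 0# ≤ 1#
  0≤1 with total 0# 1#
  ... | inj₁ 0≤1 = 0≤1
  ... | inj₂ 1≤0 = ≤-trans (*-nonNeg 0≤-1 0≤-1)
    (≤-reflexive (solve 0 ((con (+ 0) :- con (+ 1)) :* (con (+ 0) :- con (+ 1)) := con (+ 1)) refl))
    where
    0≤-1 = ≤⇒0≤ 1≤0

  1≰0 : ¬ (1# ≤ 0#)
  1≰0 1≤0 = 0≉1 (antisym 0≤1 1≤0)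

  <⇒≉ : ∀ {x} → 0# < x → ¬ (x ≈ 0#)
  <⇒≉ 0<x x≈0 = 0<x (≤-reflexive x≈0)

  ⁻¹-inverseˡ : ∀ {x} → 0# < x → x ⁻¹ * x ≈ 1#
  ⁻¹-inverseˡ {x} 0<x = trans (*-comm _ _) (⁻¹-inverseʳ (<⇒≉ 0<x))

  ⁻¹-pos : ∀ {x} → 0# < x → 0# < x ⁻¹
  ⁻¹-pos {x} 0<x x⁻¹≤0 = 1≰0 (begin
    1#          ≈⟨ ⁻¹-inverseʳ (<⇒≉ 0<x) ⟨
    x * x ⁻¹    ≤⟨ *-monoˡ-≤ (≰⇒≥ 0<x) x⁻¹≤0 ⟩
    x * 0#      ≈⟨ zeroʳ x ⟩
    0#          ∎)

  ⁻¹-nonNeg : ∀ {x} → 0# < x → 0# ≤ x ⁻¹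
  ⁻¹-nonNeg 0<x = ≰⇒≥ (⁻¹-pos 0<x)

  *-cancelˡ-≤ : ∀ {x y z} → 0# < z → z * x ≤ z * y → x ≤ y
  *-cancelˡ-≤ {x} {y} {z} 0<z zx≤zy = begin
    x               ≈⟨ unit x ⟨
    z ⁻¹ * (z * x)  ≤⟨ *-monoˡ-≤ (⁻¹-nonNeg 0<z) zx≤zy ⟩
    z ⁻¹ * (z * y)  ≈⟨ unit y ⟩
    y               ∎
    where
    unit : ∀ u → z ⁻¹ * (z * u) ≈ u
    unit u = trans (sym (*-assoc _ _ _)) (trans (*-congʳ (⁻¹-inverseˡ 0<z)) (*-identityˡ u))

  fromℕ-nonNeg : ∀ n → 0# ≤ fromℕ n
  fromℕ-nonNeg zero    = ≤-refl
  fromℕ-nonNeg (suc n) = +-nonNeg 0≤1 (fromℕ-nonNeg n)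

  fromℕ-mono : ∀ {m n} → m ℕ.≤ n → fromℕ m ≤ fromℕ n
  fromℕ-mono {n = n} z≤n = fromℕ-nonNeg n
  fromℕ-mono (s≤s m≤n)   = +-mono-≤ ≤-refl (fromℕ-mono m≤n)

  0<fromℕ : ∀ n → 0# < fromℕ (suc n)
  0<fromℕ n sn≤0 = 1≰0 (begin
    1#             ≈⟨ +-identityʳ 1# ⟨
    fromℕ 1        ≤⟨ fromℕ-mono {1} {suc n} (s≤s z≤n) ⟩
    fromℕ (suc n)  ≤⟨ sn≤0 ⟩
    0#             ∎)

  fromℕ-cancel-≤ : ∀ {m n} → fromℕ m ≤ fromℕ n → m ℕ.≤ n
  fromℕ-cancel-≤ {m} {n} m≤n with m ℕ.≤? n
  ... | yes p = p
  ... | no ¬p = contradiction (begin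
    1#                           ≈⟨ solve 1 (λ x → con (+ 1) := con (+ 1) :+ x :- x) refl (fromℕ n) ⟩
    fromℕ (suc n) - fromℕ n      ≤⟨ +-monoˡ-≤ (- fromℕ n) (fromℕ-mono (ℕ.≰⇒> ¬p)) ⟩
    fromℕ m - fromℕ n            ≤⟨ +-monoˡ-≤ (- fromℕ n) m≤n ⟩
    fromℕ n - fromℕ n            ≈⟨ -‿inverseʳ _ ⟩
    0#                           ∎) 1≰0

  fromℕ-^ : ∀ m n → fromℕ (m ℕ.^ n) ≈ fromℕ m ^ n
  fromℕ-^ m zero    = +-identityʳ 1#
  fromℕ-^ m (suc n) = trans (×1-homo-* m (m ℕ.^ n)) (*-congˡ (fromℕ-^ m n))

  ^-nonNeg : ∀ {x} n → 0# ≤ x → 0# ≤ x ^ n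
  ^-nonNeg zero    0≤x = 0≤1
  ^-nonNeg (suc n) 0≤x = *-nonNeg 0≤x (^-nonNeg n 0≤x)

  ^-mono-≤ : ∀ {x y} n → 0# ≤ x → x ≤ y → x ^ n ≤ y ^ n
  ^-mono-≤ zero    0≤x x≤y = ≤-refl
  ^-mono-≤ (suc n) 0≤x x≤y =
    *-mono-≤ (≤-trans 0≤x x≤y) (^-nonNeg n 0≤x) x≤y (^-mono-≤ n 0≤x x≤y)

  ∣∣≤⇒≤ : ∀ {x e} → ∣ x ∣ ≤ e → x ≤ e
  ∣∣≤⇒≤ {x} ∣x∣≤e with total 0# x
  ... | inj₁ _   = ∣x∣≤e
  ... | inj₂ x≤0 = ≤-trans x≤0 (≤-trans (≤-trans (≤-reflexive (sym -0#≈0#)) (neg-mono x≤0)) ∣x∣≤e)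

  ∣∣≤⇒-≤ : ∀ {x e} → ∣ x ∣ ≤ e → - x ≤ e
  ∣∣≤⇒-≤ {x} ∣x∣≤e with total 0# x
  ... | inj₁ 0≤x = ≤-trans (neg-mono 0≤x) (≤-trans (≤-trans (≤-reflexive -0#≈0#) 0≤x) ∣x∣≤e)
  ... | inj₂ _   = ∣x∣≤e

  ≤⇒∣∣≤ : ∀ {x e} → x ≤ e → - x ≤ e → ∣ x ∣ ≤ e
  ≤⇒∣∣≤ {x} x≤e -x≤e with total 0# x
  ... | inj₁ _ = x≤e
  ... | inj₂ _ = -x≤e

module Proof (lem : ExcludedMiddle 0ℓ) (𝓡 : CompleteOrderedField) where

  open Theory lem 𝓡 hiding (zero) renaming (⟨_,_⟩ to infix 9 _∙_)
  open OrderedFieldProperties 𝓡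
  open PosetReasoning poset
  open Sup _≤_ using (≤⁺-trans)
  open _≤⁺_ using (_≤⊤⁺) renaming ([_] to [_]≤)

  -- Suprema, minima and logarithms

  sup-isLUB : ∀ S → ∃ S → ∃ (IsUpperBound _≤_ S) → IsLUB _≤_ S (sup S)
  sup-isLUB S nonempty bounded with lem {∃ (IsLUB _≤_ S)}
  ... | yes (_ , isLUB) = isLUB
  ... | no ¬∃           = contradiction (complete S nonempty bounded) ¬∃

  -- The condition `0# ≤ u` takes care of the default value `0#`, so that `S` may be empty.
  sup-least : ∀ S {u} → 0# ≤ u → IsUpperBound _≤_ S u → sup S ≤ u
  sup-least S {u} 0≤u isUB with lem {∃ (IsLUB _≤_ S)}
  ... | yes (_ , isLUB) = proj₂ isLUB u isUB
  ... | no _            = 0≤u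

  -- Excluded middle either certifies the current witness as minimal or yields a smaller one; the
  -- bound `n` on the witness makes the descent terminate.
  minimum : (Q : ℕ → Set) → ∀ {k} → Q k → ∃[ l ] (Q l × (∀ j → Q j → l ℕ.≤ j))
  minimum Q {k} = descend k ℕ.≤-refl
    where
    descend : ∀ n {k} → k ℕ.≤ n → Q k → ∃[ l ] (Q l × (∀ j → Q j → l ℕ.≤ j))
    descend n {k} k≤n Qk with lem {∃[ j ] (Q j × j ℕ.< k)}
    descend n {k} k≤n Qk | no ¬∃ = k , Qk , λ j Qj → ℕ.≮⇒≥ λ j<k → ¬∃ (j , Qj , j<k)
    descend zero    k≤n Qk | yes (j , Qj , j<k) = contradiction (ℕ.≤-trans j<k k≤n) λ ()
    descend (suc n) k≤n Qk | yes (j , Qj , j<k) = descend n (ℕ.≤-pred (ℕ.≤-trans j<k k≤n)) Qj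

  -- For a communication complexity on the right of an inequality, the first case makes the
  -- inequality trivial and the second provides a protocol.
  least-view : ∀ Q → (least Q ≡ ⊤⁺) ⊎ (∃[ k ] (least Q ≡ [ k ]) × Q k)
  least-view Q with lem {∃[ k ] (Q k × (∀ l → Q l → k ℕ.≤ l))}
  ... | yes (k , Qk , _) = inj₂ (k , ≡.refl , Qk)
  ... | no _             = inj₁ ≡.refl

  least-≤ : ∀ {Q k} → Q k → ∃[ l ] (least Q ≡ [ l ]) × (l ℕ.≤ k)
  least-≤ {Q} {k} Qk with lem {∃[ k ] (Q k × (∀ l → Q l → k ℕ.≤ l))}
  ... | yes (l , _ , l≤) = l , ≡.refl , l≤ k Qk
  ... | no ¬∃            = contradiction (minimum Q Qk) ¬∃

  -- Otherwise the naturals are bounded and have a supremum s. Since n + 1 ≤ s for every n, the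
  -- smaller number s - 1 is an upper bound as well.
  archimedean : ∀ x → ∃[ n ] (x ≤ fromℕ n)
  archimedean x with lem {∃[ n ] (x ≤ fromℕ n)}
  ... | yes p = p
  ... | no ¬∃ = contradiction 1≤0 1≰0
    where
    S : ℝ → Set
    S y = ∃[ n ] (y ≈ fromℕ n)

    S-sup : IsLUB _≤_ S (sup S)
    S-sup = sup-isLUB S (fromℕ 0 , 0 , refl)
      (x , λ { y (n , y≈n) → ≤-trans (≤-reflexive y≈n) (≰⇒≥ λ x≤n → ¬∃ (n , x≤n)) })

    s-1-isUB : IsUpperBound _≤_ S (sup S - 1#)
    s-1-isUB y (n , y≈n) =
      ≤-by (≤⇒0≤ (proj₁ S-sup (fromℕ (suc n)) (suc n , refl)))
        (trans (+-congˡ (-‿cong (+-congˡ (sym y≈n))))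
          (solve 2 (λ s y → s :- (con (+ 1) :+ y) := s :- con (+ 1) :- y) refl (sup S) y))

    1≤0 : 1# ≤ 0#
    1≤0 = ≤-by (≤⇒0≤ (proj₂ S-sup _ s-1-isUB))
      (solve 1 (λ s → s :- con (+ 1) :- s := con (+ 0) :- con (+ 1)) refl (sup S))

  -- With h = 1 - q, the inequality q ^ n * (1 + n h) ≤ 1 is preserved from n
  -- to n + 1 because (1 - h) * (1 + (n + 1) h) ≤ 1 + n h.
  ^-halving : ∀ {q} → 0# ≤ q → q < 1# → ∃[ D ] (fromℕ 2 * q ^ suc D ≤ 1#)
  ^-halving {q} 0≤q q<1 = D , (begin
    fromℕ 2 * q ^ suc D                   ≈⟨ *-comm _ _ ⟩
    q ^ suc D * fromℕ 2                   ≤⟨ *-monoˡ-≤ (^-nonNeg (suc D) 0≤q) 2≤1+[1+D]h ⟩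
    q ^ suc D * (1# + fromℕ (suc D) * h)  ≤⟨ decay (suc D) ⟩
    1#                                    ∎)
    where
    h = 1# - q

    0≤h : 0# ≤ h
    0≤h = ≤⇒0≤ (≰⇒≥ q<1)

    0<h : 0# < h
    0<h h≤0 = q<1 (≤-by (≤⇒0≤ h≤0)
      (solve 1 (λ q → con (+ 0) :- (con (+ 1) :- q) := q :- con (+ 1)) refl q))

    -- From D ≥ 1 / h it follows that 1 + (D + 1) h ≥ 2, which turns the decay bound into a halving.
    D = proj₁ (archimedean (h ⁻¹))

    2≤1+[1+D]h : fromℕ 2 ≤ 1# + fromℕ (suc D) * h
    2≤1+[1+D]h = begin
      fromℕ 2                 ≈⟨ +-congˡ (+-identityʳ 1#) ⟩
      1# + 1#                 ≈⟨ +-congˡ (⁻¹-inverseʳ (<⇒≉ 0<h)) ⟨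
      1# + h * h ⁻¹           ≤⟨ +-mono-≤ ≤-refl (*-monoˡ-≤ 0≤h (proj₂ (archimedean (h ⁻¹)))) ⟩
      1# + h * fromℕ D        ≤⟨ +-mono-≤ ≤-refl (*-monoˡ-≤ 0≤h (fromℕ-mono (ℕ.n≤1+n D))) ⟩
      1# + h * fromℕ (suc D)  ≈⟨ +-congˡ (*-comm _ _) ⟩
      1# + fromℕ (suc D) * h  ∎

    decay : ∀ n → q ^ n * (1# + fromℕ n * h) ≤ 1#
    decay zero = ≤-reflexive
      (solve 1 (λ h → con (+ 1) :* (con (+ 1) :+ con (+ 0) :* h) := con (+ 1)) refl h)
    decay (suc n) = ≤-trans
      (≤-by (*-nonNeg (^-nonNeg n 0≤q) (*-nonNeg (fromℕ-nonNeg (suc n)) (*-nonNeg 0≤h 0≤h)))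
        (solve 3 (λ q p n → let h = con (+ 1) :- q in
            p :* ((con (+ 1) :+ n) :* (h :* h)) :=
            p :* (con (+ 1) :+ n :* h) :- (q :* p) :* (con (+ 1) :+ (con (+ 1) :+ n) :* h))
          refl q (q ^ n) (fromℕ n)))
      (decay n)

  -- The set whose supremum defines `log₂ x`.
  IsLogBound : ℝ → ℝ → Set
  IsLogBound x y = ∃[ m ] ∃[ k ] ∃[ d ]
    (y * fromℕ (suc d) + fromℕ k ≈ fromℕ m) ×
    (fromℕ 2 ^ m ≤ fromℕ 2 ^ k * x ^ suc d)

  -- Here 2 ^ m ≤ 2 ^ k * x ^ (d + 1) ≤ 2 ^ (k + c (d + 1)). Comparing exponents in ℕ gives m ≤ k +
  -- c (d + 1), which is y ≤ c with the denominator cleared.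
  logBound-≤ : ∀ {x} c → 0# ≤ x → x ≤ fromℕ 2 ^ c → IsUpperBound _≤_ (IsLogBound x) (fromℕ c)
  logBound-≤ {x} c 0≤x x≤2^c y (m , k , d , y≈ , 2^m≤) =
    *-cancelˡ-≤ (0<fromℕ d) (≤-by (≤⇒0≤ (fromℕ-mono m≤k+c*sd)) (begin-equality
      fromℕ (k ℕ.+ c ℕ.* suc d) - fromℕ m
        ≈⟨ +-cong (trans (×-homo-+ 1# k _) (+-congˡ (×1-homo-* c (suc d)))) (-‿cong (sym y≈)) ⟩
      fromℕ k + fromℕ c * fromℕ (suc d) - (y * fromℕ (suc d) + fromℕ k)
        ≈⟨ solve 4 (λ k c d y → k :+ c :* d :- (y :* d :+ k) := d :* c :- d :* y) refl
             (fromℕ k) (fromℕ c) (fromℕ (suc d)) y ⟩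
      fromℕ (suc d) * fromℕ c - fromℕ (suc d) * y ∎))
    where
    2^-cancel : ∀ {m n} → 2 ℕ.^ m ℕ.≤ 2 ℕ.^ n → m ℕ.≤ n
    2^-cancel {m} {n} p = ℕ.≮⇒≥ λ n<m → ℕ.<⇒≱ (ℕ.^-monoʳ-< 2 (s≤s (s≤s z≤n)) n<m) p

    m≤k+c*sd : m ℕ.≤ k ℕ.+ c ℕ.* suc d
    m≤k+c*sd = 2^-cancel (fromℕ-cancel-≤ (begin
      fromℕ (2 ℕ.^ m)                          ≈⟨ fromℕ-^ 2 m ⟩
      fromℕ 2 ^ m                              ≤⟨ 2^m≤ ⟩
      fromℕ 2 ^ k * x ^ suc d                  ≤⟨ *-monoˡ-≤ (^-nonNeg k (fromℕ-nonNeg 2)) (^-mono-≤ (suc d) 0≤x x≤2^c) ⟩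
      fromℕ 2 ^ k * (fromℕ 2 ^ c) ^ suc d      ≈⟨ *-congˡ (^-assocʳ (fromℕ 2) c (suc d)) ⟩
      fromℕ 2 ^ k * fromℕ 2 ^ (c ℕ.* suc d)    ≈⟨ ^-homo-* (fromℕ 2) k (c ℕ.* suc d) ⟨
      fromℕ 2 ^ (k ℕ.+ c ℕ.* suc d)            ≈⟨ fromℕ-^ 2 (k ℕ.+ c ℕ.* suc d) ⟨
      fromℕ (2 ℕ.^ (k ℕ.+ c ℕ.* suc d))        ∎))

  log₂-≤ : ∀ {x} c → 0# ≤ x → x ≤ fromℕ 2 ^ c → log₂ x ≤ fromℕ c
  log₂-≤ {x} c 0≤x x≤2^c = sup-least (IsLogBound x) (fromℕ-nonNeg c) (logBound-≤ c 0≤x x≤2^c)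

  n≤2^n : ∀ n → n ℕ.≤ 2 ℕ.^ n
  n≤2^n zero    = z≤n
  n≤2^n (suc n) = ℕ.+-mono-≤ (ℕ.m^n>0 2 n) (ℕ.≤-trans (n≤2^n n) (ℕ.m≤m+n _ 0))

  ≤2^ : ∀ x → ∃[ k ] (x ≤ fromℕ 2 ^ k)
  ≤2^ x with archimedean x
  ... | n , x≤n = n , ≤-trans x≤n (≤-trans (fromℕ-mono (n≤2^n n)) (≤-reflexive (fromℕ-^ 2 n)))

  -- A power of two above `x` bounds the set, so the supremum is a true one and not the default.
  log₂-≥ : ∀ {x y} → 0# ≤ x → IsLogBound x y → y ≤ log₂ x
  log₂-≥ {x} {y} 0≤x y≤ with ≤2^ x
  ... | k , x≤2^k = proj₁ (sup-isLUB (IsLogBound x) (y , y≤) (fromℕ k , logBound-≤ k 0≤x x≤2^k)) y y≤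

  log₂-≥-fromℕ : ∀ {x} k → 0# ≤ x → fromℕ 2 ^ k ≤ x → fromℕ k ≤ log₂ x
  log₂-≥-fromℕ {x} k 0≤x 2^k≤x = log₂-≥ 0≤x (k , 0 , 0 ,
    solve 1 (λ k → k :* (con (+ 1) :+ con (+ 0)) :+ con (+ 0) := k) refl (fromℕ k) ,
    ≤-trans 2^k≤x (≤-reflexive (sym (trans (*-identityˡ _) (*-identityʳ x)))))

  -- The rational 1 / (D + 1) lies in the set. For `x` between 1 and 2, where integer exponents give
  -- only 0, this keeps the logarithm away from 0.
  log₂-≥-1/ : ∀ {x} D → 0# ≤ x → fromℕ 2 ≤ x ^ suc D → 1# ≤ fromℕ (suc D) * log₂ x
  log₂-≥-1/ {x} D 0≤x 2≤x^D = begin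
    1#                                 ≈⟨ ⁻¹-inverseʳ (<⇒≉ (0<fromℕ D)) ⟨
    fromℕ (suc D) * fromℕ (suc D) ⁻¹   ≤⟨ *-monoˡ-≤ (fromℕ-nonNeg (suc D)) (log₂-≥ 0≤x
      (1 , 0 , D , +-congʳ (⁻¹-inverseˡ (0<fromℕ D)) ,
       ≤-trans (≤-reflexive (*-identityʳ _)) (≤-trans 2≤x^D (≤-reflexive (sym (*-identityˡ _)))))) ⟩
    fromℕ (suc D) * log₂ x             ∎

  -- An exponent known to be large enough is lowered until `x` is no longer below the power.
  dyadic : ∀ {x} → 1# ≤ x → ∃[ k ] (fromℕ 2 ^ k ≤ x) × (x ≤ fromℕ 2 ^ suc k)
  dyadic {x} 1≤x = search (proj₁ (≤2^ x)) (≤-trans (proj₂ (≤2^ x)) (1≤2* (proj₁ (≤2^ x))))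
    where
    1≤2* : ∀ k → fromℕ 2 ^ k ≤ fromℕ 2 ^ suc k
    1≤2* k = ≤-by (^-nonNeg k (fromℕ-nonNeg 2))
      (solve 1 (λ p → p := con (+ 2) :* p :- p) refl (fromℕ 2 ^ k))

    search : ∀ K → x ≤ fromℕ 2 ^ suc K → ∃[ k ] (fromℕ 2 ^ k ≤ x) × (x ≤ fromℕ 2 ^ suc k)
    search zero    x≤2 = 0 , 1≤x , x≤2
    search (suc K) x≤  with total x (fromℕ 2 ^ suc K)
    ... | inj₁ x≤2^K = search K x≤2^K
    ... | inj₂ 2^K≤x = suc K , 2^K≤x , x≤

  -- Expectations and repetition of protocols

  indicator : (ℝ → Set) → ℝ → ℝ
  indicator G o with lem {G o}
  ... | yes _ = 1#
  ... | no _  = 0#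

  mix-mono : ∀ {p a a′ b b′} → 0# ≤ p → p ≤ 1# → a ≤ a′ → b ≤ b′ →
             p * a + (1# - p) * b ≤ p * a′ + (1# - p) * b′
  mix-mono 0≤p p≤1 a≤a′ b≤b′ = +-mono-≤ (*-monoˡ-≤ 0≤p a≤a′) (*-monoˡ-≤ (≤⇒0≤ p≤1) b≤b′)

  module _ {n : ℕ} where

    𝔼 : Protocol n → ℝ^ n → ℝ^ n → (ℝ → ℝ) → ℝ
    𝔼 (output o)    v w f = f o
    𝔼 (alice p π ρ) v w f = Coin.bias p v * 𝔼 π v w f + (1# - Coin.bias p v) * 𝔼 ρ v w f
    𝔼 (bob p π ρ)   v w f = Coin.bias p w * 𝔼 π v w f + (1# - Coin.bias p w) * 𝔼 ρ v w f

    _then_ : Protocol n → (ℝ → Protocol n) → Protocol n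
    output o    then κ = κ o
    alice p π ρ then κ = alice p (π then κ) (ρ then κ)
    bob p π ρ   then κ = bob p (π then κ) (ρ then κ)

    cost-then : ∀ {m} (π : Protocol n) {κ} → (∀ o → cost (κ o) ℕ.≤ m) →
                cost (π then κ) ℕ.≤ cost π ℕ.+ m
    cost-then (output o)    κ≤m = κ≤m o
    cost-then {m} (alice _ π ρ) κ≤m = s≤s (ℕ.≤-trans
      (ℕ.⊔-mono-≤ (cost-then π κ≤m) (cost-then ρ κ≤m))
      (ℕ.≤-reflexive (≡.sym (ℕ.+-distribʳ-⊔ m (cost π) (cost ρ)))))
    cost-then {m} (bob _ π ρ)   κ≤m = s≤s (ℕ.≤-trans
      (ℕ.⊔-mono-≤ (cost-then π κ≤m) (cost-then ρ κ≤m))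
      (ℕ.≤-reflexive (≡.sym (ℕ.+-distribʳ-⊔ m (cost π) (cost ρ)))))

    -- Each leaf receives a fresh copy of the protocol, whose coins do not look at earlier outputs;
    -- this is what makes the runs independent.
    repeat : ∀ t → Protocol n → (Vec ℝ t → ℝ) → Protocol n
    repeat zero    π F = output (F [])
    repeat (suc t) π F = π then λ o → repeat t π λ os → F (o ∷ os)

    cost-repeat : ∀ t (π : Protocol n) F → cost (repeat t π F) ℕ.≤ t ℕ.* cost π
    cost-repeat zero    π F = z≤n
    cost-repeat (suc t) π F = cost-then π λ o → cost-repeat t π _

    module _ (v w : ℝ^ n) where

      Pr-output : ∀ G o → Pr {n} (output o) v w G ≈ indicator G o
      Pr-output G o with lem {G o}
      ... | yes _ = refl
      ... | no _  = refl

      Pr-then : ∀ π κ G → Pr (π then κ) v w G ≈ 𝔼 π v w (λ o → Pr (κ o) v w G)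
      Pr-then (output o)    κ G = refl
      Pr-then (alice p π ρ) κ G = +-cong (*-congˡ (Pr-then π κ G)) (*-congˡ (Pr-then ρ κ G))
      Pr-then (bob p π ρ)   κ G = +-cong (*-congˡ (Pr-then π κ G)) (*-congˡ (Pr-then ρ κ G))

      Pr≈𝔼 : ∀ π G → Pr π v w G ≈ 𝔼 π v w (indicator G)
      Pr≈𝔼 (output o)    G = Pr-output G o
      Pr≈𝔼 (alice p π ρ) G = +-cong (*-congˡ (Pr≈𝔼 π G)) (*-congˡ (Pr≈𝔼 ρ G))
      Pr≈𝔼 (bob p π ρ)   G = +-cong (*-congˡ (Pr≈𝔼 π G)) (*-congˡ (Pr≈𝔼 ρ G))

      𝔼-mono : ∀ π {f g} → (∀ o → f o ≤ g o) → 𝔼 π v w f ≤ 𝔼 π v w g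
      𝔼-mono (output o)    f≤g = f≤g o
      𝔼-mono (alice p π ρ) f≤g =
        mix-mono (Coin.nonneg p v) (Coin.at-most1 p v) (𝔼-mono π f≤g) (𝔼-mono ρ f≤g)
      𝔼-mono (bob p π ρ)   f≤g =
        mix-mono (Coin.nonneg p w) (Coin.at-most1 p w) (𝔼-mono π f≤g) (𝔼-mono ρ f≤g)

      mix-affine : ∀ p a c x y →
        p * (a + c * x) + (1# - p) * (a + c * y) ≈ a + c * (p * x + (1# - p) * y)
      mix-affine = solve 5 (λ p a c x y → let q = con (+ 1) :- p in
        p :* (a :+ c :* x) :+ q :* (a :+ c :* y) := a :+ c :* (p :* x :+ q :* y)) refl

      𝔼-affine : ∀ π a c f → 𝔼 π v w (λ o → a + c * f o) ≈ a + c * 𝔼 π v w f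
      𝔼-affine (output o)    a c f = refl
      𝔼-affine (alice p π ρ) a c f = trans
        (+-cong (*-congˡ (𝔼-affine π a c f)) (*-congˡ (𝔼-affine ρ a c f)))
        (mix-affine (Coin.bias p v) a c _ _)
      𝔼-affine (bob p π ρ)   a c f = trans
        (+-cong (*-congˡ (𝔼-affine π a c f)) (*-congˡ (𝔼-affine ρ a c f)))
        (mix-affine (Coin.bias p w) a c _ _)

      𝔼-affine-indicator : ∀ π a c G →
        𝔼 π v w (λ o → a + c * indicator G o) ≈ a + c * Pr π v w G
      𝔼-affine-indicator π a c G =
        trans (𝔼-affine π a c (indicator G)) (+-congˡ (*-congˡ (sym (Pr≈𝔼 π G))))

  misses : ∀ {t} → (ℝ → Set) → Vec ℝ t → ℕ
  misses G []       = 0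
  misses G (o ∷ os) with lem {G o}
  ... | yes _ = misses G os
  ... | no _  = suc (misses G os)

  -- A hit contributes the factor 1 and a miss the factor 2. Writing both as 2 minus the indicator
  -- makes the factor affine in the indicator, as `𝔼-affine-indicator` requires.
  2^misses : ∀ {t} G o (os : Vec ℝ t) →
             fromℕ 2 ^ misses G (o ∷ os) ≈ (fromℕ 2 - indicator G o) * fromℕ 2 ^ misses G os
  2^misses G o os with lem {G o}
  ... | yes _ = solve 1 (λ p → p := (con (+ 2) :- con (+ 1)) :* p) refl _
  ... | no _  = solve 1 (λ p → con (+ 2) :* p := (con (+ 2) :- con (+ 0)) :* p) refl _

  -- Pigeonhole principle: without a common hit, every output is a miss for `G` or for `H`.
  common-hit : ∀ {t} G H (os : Vec ℝ t) →
               (∃[ o ] G o × H o) ⊎ (t ℕ.≤ misses G os ℕ.+ misses H os)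
  common-hit G H [] = inj₂ z≤n
  common-hit G H (o ∷ os) with lem {G o} | lem {H o} | common-hit G H os
  ... | _      | _      | inj₁ hit = inj₁ hit
  ... | yes Go | yes Ho | inj₂ _   = inj₁ (o , Go , Ho)
  ... | yes _  | no _   | inj₂ t≤  =
    inj₂ (ℕ.≤-trans (s≤s t≤) (ℕ.≤-reflexive (≡.sym (ℕ.+-suc _ _))))
  ... | no _   | yes _  | inj₂ t≤  = inj₂ (s≤s t≤)
  ... | no _   | no _   | inj₂ t≤  =
    inj₂ (s≤s (ℕ.≤-trans t≤ (ℕ.+-monoʳ-≤ _ (ℕ.n≤1+n _))))

  -- The exponential moment method: over t independent runs the expectation of
  -- 2 ^ misses is at most r ^ t, since a single run contributes 2 - Pr.
  Pr-repeat : ∀ {n} t (π : Protocol n) v w G H F {Z r} → 0# ≤ Z → 0# ≤ r →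
    fromℕ 2 - Pr π v w G ≤ r →
    (∀ os → 1# - Z * fromℕ 2 ^ misses G os ≤ indicator H (F os)) →
    1# - Z * r ^ t ≤ Pr (repeat t π F) v w H
  Pr-repeat zero π v w G H F 0≤Z 0≤r moment bound =
    ≤-trans (bound []) (≤-reflexive (sym (Pr-output v w H (F []))))
  Pr-repeat (suc t) π v w G H F {Z} {r} 0≤Z 0≤r moment bound = begin
    1# - Z * (r * r ^ t)
      ≤⟨ ≤-by (*-nonNeg 0≤Zr^t (≤⇒0≤ moment))
           (solve 4 (λ Z r p P → Z :* p :* (r :- (con (+ 2) :- P)) :=
              con (+ 1) :- con (+ 2) :* (Z :* p) :+ Z :* p :* P :- (con (+ 1) :- Z :* (r :* p)))
            refl Z r (r ^ t) (Pr π v w G)) ⟩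
    1# - fromℕ 2 * (Z * r ^ t) + Z * r ^ t * Pr π v w G
      ≈⟨ 𝔼-affine-indicator v w π _ _ G ⟨
    𝔼 π v w (λ o → 1# - fromℕ 2 * (Z * r ^ t) + Z * r ^ t * indicator G o)
      ≤⟨ 𝔼-mono v w π step ⟩
    𝔼 π v w (λ o → Pr (repeat t π λ os → F (o ∷ os)) v w H)
      ≈⟨ Pr-then v w π _ H ⟨
    Pr (repeat (suc t) π F) v w H ∎
    where
    0≤Zr^t = *-nonNeg 0≤Z (^-nonNeg t 0≤r)

    weight-nonNeg : ∀ o → 0# ≤ fromℕ 2 - indicator G o
    weight-nonNeg o with lem {G o}
    ... | yes _ = ≤⇒0≤ (≤-trans (≤-reflexive (sym (+-identityʳ 1#))) (fromℕ-mono {1} {2} (s≤s z≤n)))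
    ... | no _  = ≤⇒0≤ (fromℕ-nonNeg 2)

    step : ∀ o → 1# - fromℕ 2 * (Z * r ^ t) + Z * r ^ t * indicator G o ≤
                 Pr (repeat t π λ os → F (o ∷ os)) v w H
    step o = begin
      1# - fromℕ 2 * (Z * r ^ t) + Z * r ^ t * indicator G o
        ≈⟨ solve 3 (λ Z p i → con (+ 1) :- con (+ 2) :* (Z :* p) :+ Z :* p :* i :=
                     con (+ 1) :- Z :* (con (+ 2) :- i) :* p) refl Z (r ^ t) (indicator G o) ⟩
      1# - Z * (fromℕ 2 - indicator G o) * r ^ t
        -- The weight of the output already read is absorbed into `Z`; this is why `Z` varies in the
        -- induction.
        ≤⟨ Pr-repeat t π v w G H (λ os → F (o ∷ os)) (*-nonNeg 0≤Z (weight-nonNeg o)) 0≤r moment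
             (λ os → ≤-trans (≤-reflexive (+-congˡ (-‿cong
               (trans (*-assoc _ _ _) (*-congˡ (sym (2^misses G o os)))))))
               (bound (o ∷ os))) ⟩
      Pr (repeat t π λ os → F (o ∷ os)) v w H ∎

  -- Amplification of the success probability

  Near : ℝ → ℝ → ℝ → Set
  Near ε x o = ∣ o - x ∣ ≤ ε

  -- Fewer than s misses among 2 s outputs form a strict majority of hits, so two majorities always
  -- share an output.
  Majority : ∀ s → ℝ → Vec ℝ (s ℕ.+ s) → ℝ → Set
  Majority s ε os x = misses (Near ε x) os ℕ.< s

  -- Any two majority points are near a common output, so the set of majority
  -- points has diameter at most 2ε and lies within ε of its supremum minus ε.
  select : ∀ s → ℝ → Vec ℝ (s ℕ.+ s) → ℝ
  select s ε os = sup (Majority s ε os) - ε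

  majority-close : ∀ s ε os {x y} → Majority s ε os x → Majority s ε os y → y ≤ x + (ε + ε)
  majority-close s ε os {x} {y} mx my with common-hit (Near ε x) (Near ε y) os
  ... | inj₁ (o , o~x , o~y) =
    ≤-by (+-nonNeg (≤⇒0≤ (∣∣≤⇒≤ o~x)) (≤⇒0≤ (∣∣≤⇒-≤ o~y)))
      (solve 4 (λ x y o ε → ε :- (o :- x) :+ (ε :- (:- (o :- y))) := x :+ (ε :+ ε) :- y) refl x y o ε)
  ... | inj₂ 2s≤ = contradiction 2s≤ (ℕ.<⇒≱ (ℕ.+-mono-< mx my))

  select-near : ∀ s ε os x → Majority s ε os x → Near ε x (select s ε os)
  select-near s ε os x mx = ≤⇒∣∣≤
    (≤-by (≤⇒0≤ (proj₂ isLUB _ isUB))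
      (solve 3 (λ x ε z → x :+ (ε :+ ε) :- z := ε :- (z :- ε :- x)) refl x ε (sup X)))
    (≤-by (≤⇒0≤ (proj₁ isLUB x mx))
      (solve 3 (λ x ε z → z :- x := ε :- (:- (z :- ε :- x))) refl x ε (sup X)))
    where
    X = Majority s ε os

    isUB : IsUpperBound _≤_ X (x + (ε + ε))
    isUB y my = majority-close s ε os mx my

    isLUB : IsLUB _≤_ X (sup X)
    isLUB = sup-isLUB X (x , mx) (_ , isUB)

  𝓒-≤-cost : ∀ {n} (N : ℝ^ n → ℝ) {ε δ} (π : Protocol n) → SolvesIP N ε δ π →
             fromℕ⁺ (𝓒 N ε δ) ≤⁺ [ fromℕ (cost π) ]
  𝓒-≤-cost N {ε} {δ} π solves
    with least-≤ {λ c → ∃[ π ] (cost π ≡ c) × SolvesIP N ε δ π} (π , ≡.refl , solves)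
  ... | l , ≡l , l≤ = ≡.subst (λ R → fromℕ⁺ R ≤⁺ [ fromℕ (cost π) ]) (≡.sym ≡l) [ fromℕ-mono l≤ ]≤

  -- chernoff = 8 / 9: two runs with failure probability 1 / 3 contribute
  -- (1 + 1 / 3)² to the expectation of 2 ^ misses, and 2 to the threshold 2 ^ s.
  half third chernoff : ℝ
  half     = fromℕ 2 ⁻¹
  third    = fromℕ 3 ⁻¹
  chernoff = half * ((1# + third) * (1# + third))

  0≤half : 0# ≤ half
  0≤half = ⁻¹-nonNeg (0<fromℕ 1)

  0≤third : 0# ≤ third
  0≤third = ⁻¹-nonNeg (0<fromℕ 2)

  0≤chernoff : 0# ≤ chernoff
  0≤chernoff = *-nonNeg 0≤half (*-nonNeg (+-nonNeg 0≤1 0≤third) (+-nonNeg 0≤1 0≤third))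

  chernoff<1 : chernoff < 1#
  chernoff<1 1≤c = 0<fromℕ 1 (≤-by
    -- The factor 18 = 2 * 3 * 3 clears the denominators: 18 * (8 / 9 - 1) = 16 - 18 = -2.
    (*-nonNeg (fromℕ-nonNeg 18) (≤⇒0≤ 1≤c))
    (begin-equality
      fromℕ 18 * (chernoff - 1#)
        ≈⟨ solve 2 (λ h t → con (+ 18) :* (h :* ((con (+ 1) :+ t) :* (con (+ 1) :+ t)) :- con (+ 1)) :=
             con (+ 2) :* h :* ((con (+ 3) :+ con (+ 3) :* t) :* (con (+ 3) :+ con (+ 3) :* t)) :- con (+ 18))
             refl half third ⟩
      fromℕ 2 * half * ((fromℕ 3 + fromℕ 3 * third) * (fromℕ 3 + fromℕ 3 * third)) - fromℕ 18
        ≈⟨ +-congʳ (*-cong (⁻¹-inverseʳ (<⇒≉ (0<fromℕ 1)))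
             (*-cong (+-congˡ (⁻¹-inverseʳ (<⇒≉ (0<fromℕ 2)))) (+-congˡ (⁻¹-inverseʳ (<⇒≉ (0<fromℕ 2)))))) ⟩
      1# * ((fromℕ 3 + 1#) * (fromℕ 3 + 1#)) - fromℕ 18
        ≈⟨ solve 0 (con (+ 1) :* ((con (+ 3) :+ con (+ 1)) :* (con (+ 3) :+ con (+ 1))) :- con (+ 18) :=
             con (+ 0) :- con (+ 2)) refl ⟩
      0# - fromℕ 2 ∎))

  1^ : ∀ s → 1# ^ s ≈ 1#
  1^ zero    = refl
  1^ (suc s) = trans (*-identityˡ _) (1^ s)

  half^-inverse : ∀ s → half ^ s * fromℕ 2 ^ s ≈ 1#
  half^-inverse s = trans (sym (^-distrib-* half (fromℕ 2) s))
    (trans (^-congˡ s (⁻¹-inverseˡ (0<fromℕ 1))) (1^ s))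
  2^-mono : ∀ {m n} → m ℕ.≤ n → fromℕ 2 ^ m ≤ fromℕ 2 ^ n
  2^-mono {m} {n} m≤n = begin
    fromℕ 2 ^ m      ≈⟨ fromℕ-^ 2 m ⟨
    fromℕ (2 ℕ.^ m)  ≤⟨ fromℕ-mono (ℕ.^-monoʳ-≤ 2 m≤n) ⟩
    fromℕ (2 ℕ.^ n)  ≈⟨ fromℕ-^ 2 n ⟩
    fromℕ 2 ^ n      ∎

  -- Markov's inequality at the threshold 2 ^ s, with `half ^ s` as the weight `Z`. A wrong
  -- selection means that the true value is no majority point, hence at least s misses, and then
  -- `half ^ s * fromℕ 2 ^ misses` is at least 1.
  SolvesIP-repeat : ∀ {n} (N : ℝ^ n → ℝ) ε s π → chernoff ^ s ≤ ε → SolvesIP N ε third π →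
                    SolvesIP N ε ε (repeat (s ℕ.+ s) π (select s ε))
  SolvesIP-repeat N ε s π q^s≤ε solves v w v≤1 w≤1 = begin
    1# - ε             ≤⟨ +-mono-≤ ≤-refl (neg-mono q^s≤ε) ⟩
    1# - chernoff ^ s  ≈⟨ +-congˡ (-‿cong q^s) ⟩
    1# - half ^ s * (1# + third) ^ (s ℕ.+ s)
      ≤⟨ Pr-repeat (s ℕ.+ s) π v w near near (select s ε) 0≤half^s (+-nonNeg 0≤1 0≤third) moment bound ⟩
    Pr (repeat (s ℕ.+ s) π (select s ε)) v w near ∎
    where
    near = Near ε (v ∙ w)

    0≤half^s = ^-nonNeg s 0≤half

    q^s : chernoff ^ s ≈ half ^ s * (1# + third) ^ (s ℕ.+ s)
    q^s = trans (^-distrib-* half _ s) (*-congˡ (trans (^-distrib-* _ _ s) (sym (^-homo-* _ s s))))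

    moment : fromℕ 2 - Pr π v w near ≤ 1# + third
    moment = ≤-by (≤⇒0≤ (solves v w v≤1 w≤1))
      (solve 2 (λ p t → p :- (con (+ 1) :- t) := con (+ 1) :+ t :- (con (+ 2) :- p)) refl _ third)

    bound : ∀ os → 1# - half ^ s * fromℕ 2 ^ misses near os ≤ indicator near (select s ε os)
    bound os with lem {near (select s ε os)}
    ... | yes _  = ≤-by (*-nonNeg 0≤half^s (^-nonNeg (misses near os) (fromℕ-nonNeg 2)))
      (solve 1 (λ z → z := con (+ 1) :- (con (+ 1) :- z)) refl _)
    ... | no ¬near = begin
      1# - half ^ s * fromℕ 2 ^ misses near os
        ≤⟨ +-mono-≤ ≤-refl (neg-mono (*-monoˡ-≤ 0≤half^s
             (2^-mono (ℕ.≮⇒≥ λ mx → ¬near (select-near s ε os _ mx))))) ⟩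
      1# - half ^ s * fromℕ 2 ^ s
        ≈⟨ +-congˡ (-‿cong (half^-inverse s)) ⟩
      1# - 1#
        ≈⟨ -‿inverseʳ 1# ⟩
      0# ∎

  2^-≥⁻¹⇒half^≤ : ∀ {ε} u → 0# < ε → ε ⁻¹ ≤ fromℕ 2 ^ u → half ^ u ≤ ε
  2^-≥⁻¹⇒half^≤ {ε} u 0<ε ε⁻¹≤2^u = begin
    half ^ u                       ≈⟨ *-identityʳ _ ⟨
    half ^ u * 1#                  ≈⟨ *-congˡ (⁻¹-inverseʳ (<⇒≉ 0<ε)) ⟨
    half ^ u * (ε * ε ⁻¹)          ≤⟨ *-monoˡ-≤ (^-nonNeg u 0≤half) (*-monoˡ-≤ (≰⇒≥ 0<ε) ε⁻¹≤2^u) ⟩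
    half ^ u * (ε * fromℕ 2 ^ u)   ≈⟨ solve 3 (λ h e p → h :* (e :* p) := e :* (h :* p)) refl _ ε _ ⟩
    ε * (half ^ u * fromℕ 2 ^ u)   ≈⟨ *-congˡ (half^-inverse u) ⟩
    ε * 1#                         ≈⟨ *-identityʳ ε ⟩
    ε                              ∎

  ⁻¹^-inverseˡ : ∀ {ε} D → 0# < ε → (ε ⁻¹) ^ D * ε ^ D ≈ 1#
  ⁻¹^-inverseˡ {ε} D 0<ε = trans (sym (^-distrib-* (ε ⁻¹) ε D))
    (trans (^-congˡ D (⁻¹-inverseˡ 0<ε)) (1^ D))

  1≤⁻¹ : ∀ {ε} → 0# < ε → ε ≤ 1# → 1# ≤ ε ⁻¹
  1≤⁻¹ {ε} 0<ε ε≤1 = begin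
    1#           ≈⟨ ⁻¹-inverseˡ 0<ε ⟨
    ε ⁻¹ * ε     ≤⟨ *-monoˡ-≤ (⁻¹-nonNeg 0<ε) ε≤1 ⟩
    ε ⁻¹ * 1#    ≈⟨ *-identityʳ _ ⟩
    ε ⁻¹         ∎

  -- Halving the failure probability bound takes a constant number 2 (d + 1) of
  -- runs, and this has to be done about log₂ (ε ⁻¹) times.  The factor D + 2
  -- absorbs the rounding, as log₂ (ε ⁻¹) is at least 1 / (D + 1) for ε ≤ ε₀.
  module _ {ε₀ : ℝ} (ε₀<1 : ε₀ < 1#) (d D : ℕ)
           (chernoff^d : fromℕ 2 * chernoff ^ suc d ≤ 1#) (ε₀^D : fromℕ 2 * ε₀ ^ suc D ≤ 1#) where

    amplificationFactor : ℕ
    amplificationFactor = (suc d ℕ.+ suc d) ℕ.* suc (suc D)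

    amplificationRounds : ∀ {ε} → 0# < ε → ε ≤ ε₀ →
      ∃[ s ] (chernoff ^ s ≤ ε) × (fromℕ (s ℕ.+ s) ≤ fromℕ amplificationFactor * log₂ (ε ⁻¹))
    amplificationRounds {ε} 0<ε ε≤ε₀ = rounds (dyadic (1≤⁻¹ 0<ε (≤-trans ε≤ε₀ (≰⇒≥ ε₀<1))))
      where
      L = log₂ (ε ⁻¹)

      0≤ε⁻¹ : 0# ≤ ε ⁻¹
      0≤ε⁻¹ = ⁻¹-nonNeg 0<ε

      2≤ε⁻¹^ : fromℕ 2 ≤ (ε ⁻¹) ^ suc D
      2≤ε⁻¹^ = begin
        fromℕ 2
          ≈⟨ *-identityʳ _ ⟨
        fromℕ 2 * 1#
          ≈⟨ *-congˡ (⁻¹^-inverseˡ (suc D) 0<ε) ⟨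
        fromℕ 2 * ((ε ⁻¹) ^ suc D * ε ^ suc D)
          ≤⟨ *-monoˡ-≤ (fromℕ-nonNeg 2) (*-monoˡ-≤ (^-nonNeg (suc D) 0≤ε⁻¹)
               (^-mono-≤ (suc D) (≰⇒≥ 0<ε) ε≤ε₀)) ⟩
        fromℕ 2 * ((ε ⁻¹) ^ suc D * ε₀ ^ suc D)
          ≈⟨ solve 3 (λ t x y → t :* (x :* y) := x :* (t :* y)) refl (fromℕ 2) _ _ ⟩
        (ε ⁻¹) ^ suc D * (fromℕ 2 * ε₀ ^ suc D)
          ≤⟨ *-monoˡ-≤ (^-nonNeg (suc D) 0≤ε⁻¹) ε₀^D ⟩
        (ε ⁻¹) ^ suc D * 1#
          ≈⟨ *-identityʳ _ ⟩
        (ε ⁻¹) ^ suc D ∎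

      rounds : ∃[ k ] (fromℕ 2 ^ k ≤ ε ⁻¹) × (ε ⁻¹ ≤ fromℕ 2 ^ suc k) →
               ∃[ s ] (chernoff ^ s ≤ ε) × (fromℕ (s ℕ.+ s) ≤ fromℕ amplificationFactor * L)
      -- Each block of d + 1 factors `chernoff` is at most one half, and k + 1 halvings go below ε
      -- because 1 / ε ≤ 2 ^ (k + 1).
      rounds (k , 2^k≤ , ≤2^u) = suc d ℕ.* suc k , q^s≤ε , (begin
          fromℕ (suc d ℕ.* suc k ℕ.+ suc d ℕ.* suc k)
            ≡⟨ ≡.cong fromℕ (ℕ.*-distribʳ-+ (suc k) (suc d) (suc d)) ⟨
          fromℕ ((suc d ℕ.+ suc d) ℕ.* suc k)
            ≈⟨ ×1-homo-* (suc d ℕ.+ suc d) (suc k) ⟩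
          fromℕ (suc d ℕ.+ suc d) * fromℕ (suc k)
            ≤⟨ *-monoˡ-≤ (fromℕ-nonNeg (suc d ℕ.+ suc d)) rounding ⟩
          fromℕ (suc d ℕ.+ suc d) * (fromℕ (suc (suc D)) * L)
            ≈⟨ *-assoc _ _ _ ⟨
          fromℕ (suc d ℕ.+ suc d) * fromℕ (suc (suc D)) * L
            ≈⟨ *-congʳ (×1-homo-* (suc d ℕ.+ suc d) (suc (suc D))) ⟨
          fromℕ amplificationFactor * L ∎)
        where
        q^s≤ε : chernoff ^ (suc d ℕ.* suc k) ≤ ε
        q^s≤ε = begin
          chernoff ^ (suc d ℕ.* suc k)
            ≈⟨ ^-assocʳ chernoff (suc d) (suc k) ⟨
          (chernoff ^ suc d) ^ suc k
            ≤⟨ ^-mono-≤ (suc k) (^-nonNeg (suc d) 0≤chernoff) (*-cancelˡ-≤ (0<fromℕ 1) (begin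
                 fromℕ 2 * chernoff ^ suc d  ≤⟨ chernoff^d ⟩
                 1#                          ≈⟨ ⁻¹-inverseʳ (<⇒≉ (0<fromℕ 1)) ⟨
                 fromℕ 2 * half              ∎)) ⟩
          half ^ suc k
            ≤⟨ 2^-≥⁻¹⇒half^≤ (suc k) 0<ε ≤2^u ⟩
          ε ∎

        rounding : fromℕ (suc k) ≤ fromℕ (suc (suc D)) * L
        rounding = begin
          1# + fromℕ k             ≤⟨ +-mono-≤ (log₂-≥-1/ D 0≤ε⁻¹ 2≤ε⁻¹^) (log₂-≥-fromℕ k 0≤ε⁻¹ 2^k≤) ⟩
          fromℕ (suc D) * L + L    ≈⟨ solve 2 (λ D L → D :* L :+ L := (con (+ 1) :+ D) :* L) refl _ L ⟩
          fromℕ (suc (suc D)) * L  ∎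

    𝓒-≤ : ∀ {n} (N : ℝ^ n → ℝ) (ε : ℝ) → 0# < ε → ε ≤ ε₀ →
      fromℕ⁺ (𝓒 N ε ε) ≤⁺ fromℕ amplificationFactor * log₂ (ε ⁻¹) *⁺ fromℕ⁺ (𝓒 N ε third)
    𝓒-≤ {n} N ε 0<ε ε≤ε₀ with least-view (λ c → ∃[ π ] (cost {n} π ≡ c) × SolvesIP N ε third π)
    ... | inj₁ ≡⊤ = ≡.subst
      (λ R → fromℕ⁺ (𝓒 N ε ε) ≤⁺ fromℕ amplificationFactor * log₂ (ε ⁻¹) *⁺ fromℕ⁺ R)
      (≡.sym ≡⊤) (_ ≤⊤⁺)
    ... | inj₂ (c , ≡c , π , ≡.refl , solves) = ≡.subst
      (λ R → fromℕ⁺ (𝓒 N ε ε) ≤⁺ fromℕ amplificationFactor * log₂ (ε ⁻¹) *⁺ fromℕ⁺ R)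
      (≡.sym ≡c) (run (amplificationRounds 0<ε ε≤ε₀))
      where
      run : ∃[ s ] (chernoff ^ s ≤ ε) × (fromℕ (s ℕ.+ s) ≤ fromℕ amplificationFactor * log₂ (ε ⁻¹)) →
            fromℕ⁺ (𝓒 N ε ε) ≤⁺ [ fromℕ amplificationFactor * log₂ (ε ⁻¹) * fromℕ c ]
      run (s , q^s≤ε , 2s≤) = ≤⁺-trans ≤-trans
        (𝓒-≤-cost N (repeat (s ℕ.+ s) π (select s ε)) (SolvesIP-repeat N ε s π q^s≤ε solves)) [ (begin
          fromℕ (cost (repeat (s ℕ.+ s) π (select s ε)))
            ≤⟨ fromℕ-mono (cost-repeat (s ℕ.+ s) π (select s ε)) ⟩
          fromℕ ((s ℕ.+ s) ℕ.* c)
            ≈⟨ ×1-homo-* (s ℕ.+ s) c ⟩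
          fromℕ (s ℕ.+ s) * fromℕ c
            ≤⟨ *-mono-≤ (≤-trans (fromℕ-nonNeg (s ℕ.+ s)) 2s≤) (fromℕ-nonNeg c) 2s≤ ≤-refl ⟩
          fromℕ amplificationFactor * log₂ (ε ⁻¹) * fromℕ c ∎) ]≤

  -- The constant is chosen before the dimension, `N` and `ε`, so it depends on `ε₀` alone. As ε
  -- tends to 1 the logarithm tends to 0, and `ε₀ < 1#` excludes this.
  𝓒-amplification : ∀ (ε₀ : ℝ) → ε₀ < 1# →
    ∃[ C ] (0# < C) ×
      (∀ {n} (N : ℝ^ n → ℝ) (ε : ℝ) → 0# < ε → ε ≤ ε₀ →
        fromℕ⁺ (𝓒 N ε ε) ≤⁺ C * log₂ (ε ⁻¹) *⁺ fromℕ⁺ (𝓒 N ε third))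
  𝓒-amplification ε₀ ε₀<1 = [ vacuous , nonvacuous ]′ (total ε₀ 0#)
    where
    Goal = ∃[ C ] (0# < C) ×
      (∀ {n} (N : ℝ^ n → ℝ) (ε : ℝ) → 0# < ε → ε ≤ ε₀ →
        fromℕ⁺ (𝓒 N ε ε) ≤⁺ C * log₂ (ε ⁻¹) *⁺ fromℕ⁺ (𝓒 N ε third))

    vacuous : ε₀ ≤ 0# → Goal
    vacuous ε₀≤0 = 1# , 1≰0 , λ N ε 0<ε ε≤ε₀ → contradiction (≤-trans ε≤ε₀ ε₀≤0) 0<ε

    combine : (∃[ d ] (fromℕ 2 * chernoff ^ suc d ≤ 1#)) →
              (∃[ D ] (fromℕ 2 * ε₀ ^ suc D ≤ 1#)) → Goal
    combine (d , chernoff^d) (D , ε₀^D) =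
      -- `K` is a product of two successors, so it computes to a successor and `suc (ℕ.pred K)` is
      -- `K` itself.
      fromℕ K , 0<fromℕ (ℕ.pred K) , 𝓒-≤ ε₀<1 d D chernoff^d ε₀^D
      where
      K = amplificationFactor ε₀<1 d D chernoff^d ε₀^D

    nonvacuous : 0# ≤ ε₀ → Goal
    nonvacuous 0≤ε₀ = combine (^-halving 0≤chernoff chernoff<1) (^-halving 0≤ε₀ ε₀<1)

  -- The norm of a symmetric polytope

  ∙-comm : ∀ {n} (v w : ℝ^ n) → v ∙ w ≈ w ∙ v
  ∙-comm v w = sum-cong-≋ λ i → *-comm (v i) (w i)

  ∙-⊘ : ∀ {n} (a v : ℝ^ n) c → a ∙ (v ⊘ c) ≈ a ∙ v * c ⁻¹
  ∙-⊘ a v c = trans (sum-cong-≋ λ i → sym (*-assoc (a i) (v i) (c ⁻¹)))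
    (sym (*-distribʳ-sum (c ⁻¹) (λ i → a i * v i)))

  ∙-neg : ∀ {n} (a v : ℝ^ n) → a ∙ neg v ≈ - a ∙ v
  ∙-neg a v = begin-equality
    a ∙ neg v  ≈⟨ sum-cong-≋ (λ i →
      solve 2 (λ a v → a :* :- v := a :* v :* :- con (+ 1)) refl (a i) (v i)) ⟩
    sum (λ i → a i * v i * - 1#)  ≈⟨ *-distribʳ-sum (- 1#) (λ i → a i * v i) ⟨
    a ∙ v * - 1#                  ≈⟨ solve 1 (λ x → x :* :- con (+ 1) := :- x) refl (a ∙ v) ⟩
    - a ∙ v                       ∎

  coordinate-bound : ∀ {n} (v : ℝ^ n) → ∃[ B ] (0# ≤ B) × (∀ i → ∣ v i ∣ ≤ B)
  coordinate-bound {zero}  v = 0# , ≤-refl , λ ()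
  coordinate-bound {suc n} v with coordinate-bound (λ i → v (suc i))
  ... | B , 0≤B , ≤B with total ∣ v zero ∣ B
  ...   | inj₁ v₀≤B = B , 0≤B , λ { zero → v₀≤B ; (suc i) → ≤B i }
  ...   | inj₂ B≤v₀ = ∣ v zero ∣ , ≤-trans 0≤B B≤v₀ ,
                      λ { zero → ≤-refl ; (suc i) → ≤-trans (≤B i) B≤v₀ }

  module _ {n M : ℕ} (P : SymmetricPolytope n M) where

    open SymmetricPolytope P hiding (b; slack; norm)

    ∈P⇒-b≤ : ∀ {v} → v ∈P → ∀ i → - b P i ≤ A i ∙ v
    ∈P⇒-b≤ {v} v∈P i = ≤-by (≤⇒0≤ (symmetric v v∈P i))
      (trans (+-congˡ (-‿cong (∙-neg (A i) v)))
        (solve 2 (λ b x → b :- (:- x) := x :- (:- b)) refl (b P i) (A i ∙ v)))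

    -- By symmetry `A i ∙ v` lies between `- b P i` and `b P i`.
    ∈P⇒0≤b : ∀ {v} → v ∈P → ∀ i → 0# ≤ b P i
    ∈P⇒0≤b {v} v∈P i with total 0# (b P i)
    ... | inj₁ 0≤b = 0≤b
    ... | inj₂ b≤0 = begin
      0#       ≈⟨ -0#≈0# ⟨
      - 0#     ≤⟨ neg-mono b≤0 ⟩
      - b P i  ≤⟨ ∈P⇒-b≤ v∈P i ⟩
      A i ∙ v  ≤⟨ v∈P i ⟩
      b P i    ∎

    ⊘∈P⇒≤ : ∀ {v c} → 0# < c → (v ⊘ c) ∈P → ∀ i → A i ∙ v ≤ c * b P i
    ⊘∈P⇒≤ {v} {c} 0<c v⊘c∈P i = begin
      A i ∙ v                 ≈⟨ *-identityʳ _ ⟨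
      A i ∙ v * 1#            ≈⟨ *-congˡ (⁻¹-inverseʳ (<⇒≉ 0<c)) ⟨
      A i ∙ v * (c * c ⁻¹)    ≈⟨ solve 3 (λ x c d → x :* (c :* d) := c :* (x :* d)) refl _ c _ ⟩
      c * ((A i ∙ v) * c ⁻¹)  ≈⟨ *-congˡ (∙-⊘ (A i) v c) ⟨
      c * A i ∙ (v ⊘ c)       ≤⟨ *-monoˡ-≤ (≰⇒≥ 0<c) (v⊘c∈P i) ⟩
      c * b P i               ∎

    ≤⇒⊘∈P : ∀ {v c} → 0# < c → (∀ i → A i ∙ v ≤ c * b P i) → (v ⊘ c) ∈P
    ≤⇒⊘∈P {v} {c} 0<c ≤cb i = begin
      A i ∙ (v ⊘ c)       ≈⟨ ∙-⊘ (A i) v c ⟩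
      A i ∙ v * c ⁻¹      ≈⟨ *-comm _ _ ⟩
      c ⁻¹ * A i ∙ v      ≤⟨ *-monoˡ-≤ (⁻¹-nonNeg 0<c) (≤cb i) ⟩
      c ⁻¹ * (c * b P i)  ≈⟨ *-assoc _ _ _ ⟨
      c ⁻¹ * c * b P i    ≈⟨ *-congʳ (⁻¹-inverseˡ 0<c) ⟩
      1# * b P i          ≈⟨ *-identityˡ _ ⟩
      b P i               ∎

    -- The norm is minus the supremum of these t, which are the negatives of
    -- the admissible scaling factors.
    Scaling : ℝ^ n → ℝ → Set
    Scaling v t = (0# < - t) × ((v ⊘ (- t)) ∈P)

    absorbing : ∀ v → ∃ (Scaling v)
    absorbing v with interior | coordinate-bound v
    ... | r , 0<r , cube⊆P | B , 0≤B , ∣v∣≤B = t , 0<c , cube⊆P (v ⊘ c) λ i →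
        ≤⇒∣∣≤ (shrink (∣∣≤⇒≤ (∣v∣≤B i)))
          (≤-trans (≤-reflexive (RingProperties.-‿distribˡ-* ring _ _)) (shrink (∣∣≤⇒-≤ (∣v∣≤B i))))
      where
      -- Dividing by c = (B + 1) / r brings every coordinate into the cube of radius r inside P. The
      -- summand 1 keeps c positive even when B is 0.
      t = - (r ⁻¹ * (B + 1#))
      c = - t

      rc≈B+1 : r * c ≈ B + 1#
      rc≈B+1 = begin-equality
        r * c                ≈⟨ *-congˡ (-‿involutive _) ⟩
        r * (r ⁻¹ * (B + 1#))  ≈⟨ *-assoc _ _ _ ⟨
        r * r ⁻¹ * (B + 1#)  ≈⟨ *-congʳ (⁻¹-inverseʳ (<⇒≉ 0<r)) ⟩
        1# * (B + 1#)        ≈⟨ *-identityˡ _ ⟩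
        B + 1#               ∎

      0<c : 0# < c
      0<c c≤0 = 1≰0 (begin
        1#       ≈⟨ +-identityˡ 1# ⟨
        0# + 1#  ≤⟨ +-monoˡ-≤ 1# 0≤B ⟩
        B + 1#   ≈⟨ rc≈B+1 ⟨
        r * c    ≤⟨ *-monoˡ-≤ (≰⇒≥ 0<r) c≤0 ⟩
        r * 0#   ≈⟨ zeroʳ r ⟩
        0#       ∎)

      shrink : ∀ {x} → x ≤ B → x * c ⁻¹ ≤ r
      shrink {x} x≤B = begin
        x * c ⁻¹        ≈⟨ *-comm _ _ ⟩
        c ⁻¹ * x        ≤⟨ *-monoˡ-≤ (⁻¹-nonNeg 0<c) (begin
          x               ≤⟨ x≤B ⟩
          B               ≤⟨ ≤-by 0≤1 (solve 1 (λ B → con (+ 1) := B :+ con (+ 1) :- B) refl B) ⟩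
          B + 1#          ≈⟨ rc≈B+1 ⟨
          r * c           ∎) ⟩
        c ⁻¹ * (r * c)  ≈⟨ solve 3 (λ d r c → d :* (r :* c) := r :* (d :* c)) refl _ r c ⟩
        r * (c ⁻¹ * c)  ≈⟨ *-congˡ (⁻¹-inverseˡ 0<c) ⟩
        r * 1#          ≈⟨ *-identityʳ r ⟩
        r               ∎

    -- The set is inhabited by `absorbing` and bounded above by `0#`, so the norm is a true infimum
    -- and never the default.
    Scaling-sup : ∀ v → IsLUB _≤_ (Scaling v) (sup (Scaling v))
    Scaling-sup v = sup-isLUB _ (absorbing v) (0# , λ t (0<-t , _) →
      ≤-by (≰⇒≥ 0<-t) (sym (+-identityˡ (- t))))

    ∈P⇒norm≤1 : ∀ {v} → v ∈P → norm P v ≤ 1#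
    ∈P⇒norm≤1 {v} v∈P = begin
      - sup (Scaling v)  ≤⟨ neg-mono (proj₁ (Scaling-sup v) (- 1#) (0<1 ,
        ≤⇒⊘∈P 0<1 λ i → ≤-trans (v∈P i)
          (≤-reflexive (trans (sym (*-identityˡ _)) (*-congʳ (sym (-‿involutive 1#))))))) ⟩
      - - 1#             ≈⟨ -‿involutive 1# ⟩
      1#                 ∎
      where
      0<1 : 0# < - - 1#
      0<1 p = 1≰0 (≤-trans (≤-reflexive (sym (-‿involutive 1#))) p)

    norm≤1⇒∈P : ∀ {v} → norm P v ≤ 1# → v ∈P
    norm≤1⇒∈P {v} norm≤1 i with lem {b P i ≤ 0#}
    ... | yes b≤0 = begin
      A i ∙ v    ≤⟨ ⊘∈P⇒≤ 0<c v⊘c∈P i ⟩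
      c * b P i  ≤⟨ *-monoˡ-≤ (≰⇒≥ 0<c) b≤0 ⟩
      c * 0#     ≈⟨ zeroʳ c ⟩
      0#         ≤⟨ ∈P⇒0≤b v⊘c∈P i ⟩
      b P i      ∎
      where
      c     = - proj₁ (absorbing v)
      0<c   = proj₁ (proj₂ (absorbing v))
      v⊘c∈P = proj₂ (proj₂ (absorbing v))
    ... | no 0<b = *-cancelˡ-≤ (⁻¹-pos 0<b) (begin
      b P i ⁻¹ * A i ∙ v  ≈⟨ -‿involutive _ ⟨
      - - (b P i ⁻¹ * A i ∙ v)
        ≤⟨ neg-mono (proj₂ (Scaling-sup v) _ λ t (0<c , v⊘c∈P) → ≤-trans
             (≤-reflexive (sym (-‿involutive t))) (neg-mono (begin
               b P i ⁻¹ * A i ∙ v        ≤⟨ *-monoˡ-≤ (⁻¹-nonNeg 0<b) (⊘∈P⇒≤ 0<c v⊘c∈P i) ⟩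
               b P i ⁻¹ * (- t * b P i)  ≈⟨ solve 3 (λ d t b → d :* (:- t :* b) := :- t :* (d :* b)) refl _ t _ ⟩
               - t * (b P i ⁻¹ * b P i)  ≈⟨ *-congˡ (⁻¹-inverseˡ 0<b) ⟩
               - t * 1#                  ≈⟨ *-identityʳ _ ⟩
               - t                       ∎))) ⟩
      norm P v                 ≤⟨ norm≤1 ⟩
      1#                       ≈⟨ ⁻¹-inverseˡ 0<b ⟨
      b P i ⁻¹ * b P i         ∎)

    -- The unit ball of the norm is contained in P, where `A i` is at most `b P i`. The
    -- normalisation of `b` thus makes the rows valid inputs for Bob.
    dual-norm≤1 : (∀ i → b P i ≤ 1#) → ∀ i → dual (norm P) (A i) ≤ 1#
    dual-norm≤1 b≤1 i = sup-least _ 0≤1 λ { x (v , norm≤1 , x≈) → begin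
      x        ≈⟨ x≈ ⟩
      v ∙ A i  ≈⟨ ∙-comm v (A i) ⟩
      A i ∙ v  ≤⟨ norm≤1⇒∈P norm≤1 i ⟩
      b P i    ≤⟨ b≤1 i ⟩
      1#       ∎ }

  -- Non-negative factorizations from protocols

  sum-++ : ∀ {m n} (xs : Vector ℝ m) (ys : Vector ℝ n) → sum (xs ++ ys) ≈ sum xs + sum ys
  sum-++ {zero}  xs ys = sym (+-identityˡ _)
  sum-++ {suc m} xs ys = trans
    (+-congˡ (trans (sum-cong-≋ tail-++) (sum-++ (λ i → xs (suc i)) ys)))
    (sym (+-assoc _ _ _))
    where
    tail-++ : ∀ i → (xs ++ ys) (suc i) ≈ ((λ i → xs (suc i)) ++ ys) i
    tail-++ i with splitAt m i
    ... | inj₁ _ = refl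
    ... | inj₂ _ = refl

  module _ {I J : Set} where

    factor-col : (φ : J → ℝ) → (∀ j → 0# ≤ φ j) → HasNonnegFactorization {I} (λ _ → φ) 1
    factor-col φ 0≤φ = (λ _ _ → 1#) , (λ _ → φ) , (λ _ _ → 0≤1) , (λ _ → 0≤φ) ,
      λ _ j → sym (trans (+-identityʳ _) (*-identityˡ _))

    factor-+ : ∀ {S T : I → J → ℝ} {r s} → HasNonnegFactorization S r → HasNonnegFactorization T s →
               HasNonnegFactorization (λ i j → S i j + T i j) (r ℕ.+ s)
    factor-+ {r = r} (a , c , 0≤a , 0≤c , S≈) (a′ , c′ , 0≤a′ , 0≤c′ , T≈) =
      a ++ a′ , c ++ c′ , ++-nonNeg 0≤a 0≤a′ , ++-nonNeg 0≤c 0≤c′ , λ i j →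
        trans (+-cong (S≈ i j) (T≈ i j)) (trans
          (sym (sum-++ (λ k → a k i * c k j) (λ k → a′ k i * c′ k j)))
          (sum-cong-≋ (++-* i j)))
      where
      ++-nonNeg : ∀ {X : Set} {m n} {f : Fin m → X → ℝ} {g : Fin n → X → ℝ} →
        (∀ k x → 0# ≤ f k x) → (∀ k x → 0# ≤ g k x) → ∀ k x → 0# ≤ (f ++ g) k x
      ++-nonNeg {m = m} 0≤f 0≤g k x with splitAt m k
      ... | inj₁ k = 0≤f k x
      ... | inj₂ k = 0≤g k x

      ++-* : ∀ i j k → ((λ k → a k i * c k j) ++ (λ k → a′ k i * c′ k j)) k ≈
                       (a ++ a′) k i * (c ++ c′) k j
      ++-* i j k with splitAt r k
      ... | inj₁ _ = refl
      ... | inj₂ _ = refl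

    factor-scaleRows : ∀ {S : I → J → ℝ} {r} {p : I → ℝ} → (∀ i → 0# ≤ p i) →
      HasNonnegFactorization S r → HasNonnegFactorization (λ i j → p i * S i j) r
    factor-scaleRows {p = p} 0≤p (a , c , 0≤a , 0≤c , S≈) =
      (λ k i → p i * a k i) , c , (λ k i → *-nonNeg (0≤p i) (0≤a k i)) , 0≤c , λ i j →
        trans (*-congˡ (S≈ i j)) (trans (*-distribˡ-sum (p i) λ k → a k i * c k j)
          (sum-cong-≋ λ k → sym (*-assoc (p i) (a k i) (c k j))))

    factor-scaleCols : ∀ {S : I → J → ℝ} {r} {p : J → ℝ} → (∀ j → 0# ≤ p j) →
      HasNonnegFactorization S r → HasNonnegFactorization (λ i j → p j * S i j) r
    factor-scaleCols {p = p} 0≤p (a , c , 0≤a , 0≤c , S≈) =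
      a , (λ k j → p j * c k j) , 0≤a , (λ k j → *-nonNeg (0≤p j) (0≤c k j)) , λ i j →
        trans (*-congˡ (S≈ i j)) (trans (*-distribˡ-sum (p j) λ k → a k i * c k j)
          (sum-cong-≋ λ k → solve 3 (λ p a c → p :* (a :* c) := a :* (p :* c)) refl (p j) (a k i) (c k j)))

    2^-⊔ : ∀ {r s} c d → r ℕ.≤ 2 ℕ.^ c → s ℕ.≤ 2 ℕ.^ d → r ℕ.+ s ℕ.≤ 2 ℕ.^ suc (c ℕ.⊔ d)
    2^-⊔ c d r≤ s≤ = ℕ.+-mono-≤
      (ℕ.≤-trans r≤ (ℕ.^-monoʳ-≤ 2 (ℕ.m≤m⊔n c d)))
      (ℕ.≤-trans (ℕ.≤-trans s≤ (ℕ.^-monoʳ-≤ 2 (ℕ.m≤n⊔m c d))) (ℕ.m≤m+n _ 0))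

    -- A coin of Alice rescales rows and a coin of Bob rescales columns, so the numbers of terms
    -- only add up along the tree. The leaf value may depend on the column, as decoding uses
    -- `b P i`, and still costs a single term.
    factor-𝔼 : ∀ {n} (π : Protocol n) (α : I → ℝ^ n) (β : J → ℝ^ n) (φ : ℝ → J → ℝ) →
      (∀ o j → 0# ≤ φ o j) →
      ∃[ r ] (r ℕ.≤ 2 ℕ.^ cost π) ×
        HasNonnegFactorization (λ i j → 𝔼 π (α i) (β j) (λ o → φ o j)) r
    factor-𝔼 (output o)    α β φ 0≤φ = 1 , ℕ.≤-refl , factor-col (φ o) (0≤φ o)
    factor-𝔼 (alice p π ρ) α β φ 0≤φ with factor-𝔼 π α β φ 0≤φ | factor-𝔼 ρ α β φ 0≤φ
    ... | r , r≤ , fπ | s , s≤ , fρ = r ℕ.+ s , 2^-⊔ (cost π) (cost ρ) r≤ s≤ , factor-+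
      (factor-scaleRows (λ i → Coin.nonneg p (α i)) fπ)
      (factor-scaleRows (λ i → ≤⇒0≤ (Coin.at-most1 p (α i))) fρ)
    factor-𝔼 (bob p π ρ)   α β φ 0≤φ with factor-𝔼 π α β φ 0≤φ | factor-𝔼 ρ α β φ 0≤φ
    ... | r , r≤ , fπ | s , s≤ , fρ = r ℕ.+ s , 2^-⊔ (cost π) (cost ρ) r≤ s≤ , factor-+
      (factor-scaleCols (λ j → Coin.nonneg p (β j)) fπ)
      (factor-scaleCols (λ j → ≤⇒0≤ (Coin.at-most1 p (β j))) fρ)

    log₂-approxRk⁺-≤ : ∀ {S : I → J → ℝ} {η} S′ {r} c → (∀ i j → ∣ S i j - S′ i j ∣ ≤ η) →
      HasNonnegFactorization S′ r → r ℕ.≤ 2 ℕ.^ c → log₂⁺ (approxRk⁺ η S) ≤⁺ [ fromℕ c ]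
    log₂-approxRk⁺-≤ {S} {η} S′ c close factor r≤2^c with least-≤ factor
    ... | l , ≡l , l≤r with least-≤ {λ r → Σ (I → J → ℝ) λ S′ →
                              (∀ i j → ∣ S i j - S′ i j ∣ ≤ η) × (rk⁺ S′ ≡ [ r ])} (S′ , close , ≡l)
    ...   | k , ≡k , k≤l = ≡.subst (λ R → log₂⁺ R ≤⁺ [ fromℕ c ]) (≡.sym ≡k)
      [ log₂-≤ c (fromℕ-nonNeg k) (≤-trans (fromℕ-mono (ℕ.≤-trans k≤l (ℕ.≤-trans l≤r r≤2^c)))
          (≤-reflexive (fromℕ-^ 2 c))) ]≤

  -- Decoding

  clamp : ℝ → ℝ → ℝ
  clamp b y with total y (- b) | total b y
  ... | inj₁ _ | _      = - b
  ... | inj₂ _ | inj₁ _ = b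
  ... | inj₂ _ | inj₂ _ = y

  -b≤b : ∀ {b} → 0# ≤ b → - b ≤ b
  -b≤b 0≤b = ≤-trans (neg-mono 0≤b) (≤-trans (≤-reflexive -0#≈0#) 0≤b)

  clamp≤b : ∀ {b} y → 0# ≤ b → clamp b y ≤ b
  clamp≤b {b} y 0≤b with total y (- b) | total b y
  ... | inj₁ _ | _        = -b≤b 0≤b
  ... | inj₂ _ | inj₁ _   = ≤-refl
  ... | inj₂ _ | inj₂ y≤b = y≤b

  -b≤clamp : ∀ {b} y → 0# ≤ b → - b ≤ clamp b y
  -b≤clamp {b} y 0≤b with total y (- b) | total b y
  ... | inj₁ _    | _      = ≤-refl
  ... | inj₂ _    | inj₁ _ = -b≤b 0≤b
  ... | inj₂ -b≤y | inj₂ _ = -b≤y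

  clamp≤ : ∀ {b y z} → - b ≤ z → y ≤ z → clamp b y ≤ z
  clamp≤ {b} {y} -b≤z y≤z with total y (- b) | total b y
  ... | inj₁ _ | _        = -b≤z
  ... | inj₂ _ | inj₁ b≤y = ≤-trans b≤y y≤z
  ... | inj₂ _ | inj₂ _   = y≤z

  ≤clamp : ∀ {b y z} → z ≤ b → z ≤ y → z ≤ clamp b y
  ≤clamp {b} {y} z≤b z≤y with total y (- b) | total b y
  ... | inj₁ y≤-b | _      = ≤-trans z≤y y≤-b
  ... | inj₂ _    | inj₁ _ = z≤b
  ... | inj₂ _    | inj₂ _ = z≤y

  -- Dividing the output by 1 - ε before clamping it to [-b, b] is what brings
  -- the error of the expectation down to 2ε (without the division it is 3ε):
  -- the factor cancels against the success probability 1 - ε, leaving ε from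
  -- the accuracy and ε b ≤ ε from the failures.
  module _ {ε : ℝ} (0≤ε : 0# ≤ ε) (ε<1 : ε < 1#) where

    private
      u : ℝ
      u = (1# - ε) ⁻¹

      0<1-ε : 0# < 1# - ε
      0<1-ε p = ε<1 (≤-by (≤⇒0≤ p)
        (solve 1 (λ e → con (+ 0) :- (con (+ 1) :- e) := e :- con (+ 1)) refl ε))

      0≤u : 0# ≤ u
      0≤u = ⁻¹-nonNeg 0<1-ε

      cancel-u : ∀ y → (1# - ε) * (u * y) ≈ y
      cancel-u y = trans (sym (*-assoc _ _ _))
        (trans (*-congʳ (⁻¹-inverseʳ (<⇒≉ 0<1-ε))) (*-identityˡ y))

    decode : ℝ → ℝ → ℝ
    decode b o = clamp b (u * o)

    -- Let U = u (y + ε). If U ≤ b, then `g` is at most U on `G` and at most b elsewhere; the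
    -- resulting bound is worst when `G` has probability exactly 1 - ε, where it is ε b + (1 - ε) U
    -- = ε b + y + ε. If b ≤ U, the bound b on `g` is good enough.
    𝔼-≤-of-near : ∀ {n} (π : Protocol n) v w G g {b y} → b ≤ 1# → 1# - ε ≤ Pr π v w G →
      (∀ o → g o ≤ b) → (∀ o → G o → g o ≤ u * (y + ε)) → 𝔼 π v w g ≤ y + fromℕ 2 * ε
    𝔼-≤-of-near π v w G g {b} {y} b≤1 pr g≤b g≤U with total (u * (y + ε)) b
    ... | inj₁ U≤b = begin
      𝔼 π v w g
        ≤⟨ 𝔼-mono v w π pointwise ⟩
      𝔼 π v w (λ o → b + - (b - U) * indicator G o)
        ≈⟨ 𝔼-affine-indicator v w π b (- (b - U)) G ⟩
      b + - (b - U) * Pr π v w G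
        ≤⟨ ≤-by (*-nonNeg (≤⇒0≤ U≤b) (≤⇒0≤ pr))
             (solve 4 (λ b U p e → (b :- U) :* (p :- (con (+ 1) :- e)) :=
                b :* e :+ (con (+ 1) :- e) :* U :- (b :+ :- (b :- U) :* p)) refl b U _ ε) ⟩
      b * ε + (1# - ε) * U
        ≈⟨ +-congˡ (cancel-u (y + ε)) ⟩
      b * ε + (y + ε)
        ≤⟨ ≤-by (*-nonNeg 0≤ε (≤⇒0≤ b≤1))
             (solve 3 (λ b y e → e :* (con (+ 1) :- b) := y :+ con (+ 2) :* e :- (b :* e :+ (y :+ e)))
               refl b y ε) ⟩
      y + fromℕ 2 * ε ∎
      where
      U = u * (y + ε)

      pointwise : ∀ o → g o ≤ b + - (b - U) * indicator G o
      pointwise o with lem {G o}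
      ... | yes Go = ≤-trans (g≤U o Go) (≤-reflexive
        (solve 2 (λ b U → U := b :+ :- (b :- U) :* con (+ 1)) refl b U))
      ... | no _   = ≤-trans (g≤b o) (≤-reflexive
        (solve 2 (λ b U → b := b :+ :- (b :- U) :* con (+ 0)) refl b U))
    ... | inj₂ b≤U = begin
      𝔼 π v w g
        ≤⟨ 𝔼-mono v w π (λ o → ≤-trans (g≤b o) (≤-reflexive (sym (collapse (indicator G o))))) ⟩
      𝔼 π v w (λ o → b + 0# * indicator G o)
        ≈⟨ trans (𝔼-affine-indicator v w π b 0# G) (collapse _) ⟩
      b
        ≈⟨ solve 2 (λ b e → b := (con (+ 1) :- e) :* b :+ e :* b) refl b ε ⟩
      (1# - ε) * b + ε * b
        ≤⟨ +-mono-≤ (*-monoˡ-≤ (≰⇒≥ 0<1-ε) b≤U) (*-monoˡ-≤ 0≤ε b≤1) ⟩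
      (1# - ε) * (u * (y + ε)) + ε * 1#
        ≈⟨ +-congʳ (cancel-u (y + ε)) ⟩
      y + ε + ε * 1#
        ≈⟨ solve 2 (λ y e → y :+ e :+ e :* con (+ 1) := y :+ con (+ 2) :* e) refl y ε ⟩
      y + fromℕ 2 * ε ∎
      where
      collapse : ∀ z → b + 0# * z ≈ b
      collapse = solve 2 (λ b z → b :+ con (+ 0) :* z := b) refl b

    -- Raising a value to the lower end of the clamping interval must not break the estimate.
    -- Multiplied by 1 - ε, the claim follows from y + b ≥ 0 and ε (1 - b) ≥ 0.
    -b≤u* : ∀ {b y} → b ≤ 1# → - b ≤ y → - b ≤ u * (y + ε)
    -b≤u* {b} {y} b≤1 -b≤y = *-cancelˡ-≤ 0<1-ε (≤-trans
      (≤-by (+-nonNeg (≤⇒0≤ -b≤y) (*-nonNeg 0≤ε (≤⇒0≤ b≤1)))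
        (solve 3 (λ b y e → y :- :- b :+ e :* (con (+ 1) :- b) :=
          y :+ e :- (con (+ 1) :- e) :* :- b) refl b y ε))
      (≤-reflexive (sym (cancel-u (y + ε)))))

    decode-error : ∀ {n} (π : Protocol n) v w {b x} → 0# ≤ b → b ≤ 1# → - b ≤ x → x ≤ b →
      1# - ε ≤ Pr π v w (Near ε x) →
      (𝔼 π v w (decode b) ≤ x + fromℕ 2 * ε) ×
      (x - fromℕ 2 * ε ≤ 𝔼 π v w (decode b))
    decode-error π v w {b} {x} 0≤b b≤1 -b≤x x≤b pr =
      𝔼-≤-of-near π v w (Near ε x) (decode b) b≤1 pr
        (λ o → clamp≤b _ 0≤b)
        (λ o o~x → clamp≤ (-b≤u* b≤1 -b≤x) (*-monoˡ-≤ 0≤u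
          (≤-by (≤⇒0≤ (∣∣≤⇒≤ o~x)) (solve 3 (λ o x e → e :- (o :- x) := x :+ e :- o) refl o x ε)))) ,
      -- The lower estimate is the upper one for the negated decoded output and `- x`; the negation
      -- is written in the affine form that `𝔼-affine` expects.
      ≤-by (≤⇒0≤ (𝔼-≤-of-near π v w (Near ε x) (λ o → 0# + - 1# * decode b o) b≤1 pr
        (λ o → ≤-by (≤⇒0≤ (-b≤clamp (u * o) 0≤b))
          (solve 2 (λ f b → f :- :- b := b :- (con (+ 0) :+ :- con (+ 1) :* f)) refl _ b))
        (λ o o~x → ≤-by (≤⇒0≤ (≤clamp {b} {u * o} {u * (x - ε)} (u[x-ε]≤b) (*-monoˡ-≤ 0≤u
            (≤-by (≤⇒0≤ (∣∣≤⇒-≤ o~x)) (solve 3 (λ o x e → e :- (:- (o :- x)) := o :- (x :- e)) refl o x ε)))))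
          (solve 4 (λ f u x e → f :- u :* (x :- e) :=
            u :* (:- x :+ e) :- (con (+ 0) :+ :- con (+ 1) :* f)) refl (decode b o) u x ε))))
        (trans (+-congˡ (-‿cong (𝔼-affine v w π 0# (- 1#) (decode b))))
          (solve 3 (λ x e f → :- x :+ con (+ 2) :* e :- (con (+ 0) :+ :- con (+ 1) :* f) :=
            f :- (x :- con (+ 2) :* e)) refl x ε _))
      where
      u[x-ε]≤b : u * (x - ε) ≤ b
      u[x-ε]≤b = ≤-by (≤⇒0≤ (-b≤u* {b} {(- x)} b≤1 (neg-mono x≤b)))
        (solve 4 (λ u x e b → u :* (:- x :+ e) :- :- b := b :- u :* (x :- e)) refl u x ε b)

  -- The lower bound by the approximate non-negative rank of the slack matrix, and both bounds
  -- together.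

  log₂-approxRk⁺-slack : ∀ {n M : ℕ} (P : SymmetricPolytope n M) (ε : ℝ) → 0# < ε →
    (∀ i → b P i ≤ 1#) →
    log₂⁺ (approxRk⁺ (fromℕ 2 * ε) (slack P)) ≤⁺ fromℕ⁺ (𝓒 (norm P) ε ε)
  log₂-approxRk⁺-slack {n} P ε 0<ε b≤1
    with least-view (λ c → ∃[ π ] (cost {n} π ≡ c) × SolvesIP (norm P) ε ε π)
  ... | inj₁ ≡⊤ = ≡.subst
    (λ R → log₂⁺ (approxRk⁺ (fromℕ 2 * ε) (slack P)) ≤⁺ fromℕ⁺ R) (≡.sym ≡⊤) (_ ≤⊤⁺)
  ... | inj₂ (c , ≡c , π , ≡.refl , solves) = ≡.subst
    (λ R → log₂⁺ (approxRk⁺ (fromℕ 2 * ε) (slack P)) ≤⁺ fromℕ⁺ R) (≡.sym ≡c) bound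
    where
    open SymmetricPolytope P using (A; Vertex; _∈P)

    bound : log₂⁺ (approxRk⁺ (fromℕ 2 * ε) (slack P)) ≤⁺ [ fromℕ c ]
    bound with lem {1# ≤ ε}
    -- The slack lies between 0 and 2 b ≤ 2 ε, and the zero matrix has a factorization with no terms
    -- at all.
    ... | yes 1≤ε = log₂-approxRk⁺-≤ (λ _ _ → 0#) c (λ { (v , v∈P , _) i → ≤⇒∣∣≤
      (≤-by (+-nonNeg (≤⇒0≤ (∈P⇒-b≤ P v∈P i)) (*-nonNeg (fromℕ-nonNeg 2) (≤⇒0≤ (≤-trans (b≤1 i) 1≤ε))))
        (solve 3 (λ b x e → x :- :- b :+ con (+ 2) :* (e :- b) := con (+ 2) :* e :- (b :- x :- con (+ 0)))
          refl (b P i) (A i ∙ v) ε))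
      (≤-by (+-nonNeg (≤⇒0≤ (v∈P i)) (*-nonNeg (fromℕ-nonNeg 2) (≰⇒≥ 0<ε)))
        (solve 3 (λ b x e → b :- x :+ con (+ 2) :* e := con (+ 2) :* e :- (:- (b :- x :- con (+ 0))))
          refl (b P i) (A i ∙ v) ε)) })
      ((λ ()) , (λ ()) , (λ ()) , (λ ()) , λ _ _ → refl) z≤n
    ... | no ε<1 = assemble (factor-𝔼 π proj₁ A entry λ o i →
        ≤-by (≤⇒0≤ (clamp≤b _ (0≤b i))) (solve 2 (λ b f →
          b :- f := b :+ :- con (+ 1) :* f :- con (+ 0)) refl (b P i) _))
      where
      0≤ε = ≰⇒≥ 0<ε

      0≤b : ∀ i → 0# ≤ b P i
      -- Any point of P will do here; `absorbing` exhibits one as a rescaled origin.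
      0≤b = ∈P⇒0≤b P (proj₂ (proj₂ (absorbing P λ _ → 0#)))

      entry : ℝ → Fin _ → ℝ
      entry o i = b P i + - 1# * decode 0≤ε ε<1 (b P i) o

      S′ : Vertex → Fin _ → ℝ
      S′ v i = 𝔼 π (proj₁ v) (A i) (λ o → entry o i)

      close : ∀ v i → ∣ slack P v i - S′ v i ∣ ≤ fromℕ 2 * ε
      close (v , v∈P , _) i = ≤⇒∣∣≤
        (≤-by (≤⇒0≤ (proj₁ error)) (trans (solve 4 (λ b x e f →
            x :+ con (+ 2) :* e :- f := con (+ 2) :* e :- (b :- x :- (b :+ :- con (+ 1) :* f)))
            refl (b P i) (v ∙ A i) ε F) (+-congˡ (-‿cong S-S′))))
        (≤-by (≤⇒0≤ (proj₂ error)) (trans (solve 4 (λ b x e f →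
            f :- (x :- con (+ 2) :* e) := con (+ 2) :* e :- :- (b :- x :- (b :+ :- con (+ 1) :* f)))
            refl (b P i) (v ∙ A i) ε F) (+-congˡ (-‿cong (-‿cong S-S′)))))
        where
        F = 𝔼 π v (A i) (decode 0≤ε ε<1 (b P i))

        error : (F ≤ v ∙ A i + fromℕ 2 * ε) × (v ∙ A i - fromℕ 2 * ε ≤ F)
        error = decode-error 0≤ε ε<1 π v (A i) (0≤b i) (b≤1 i)
          (≤-trans (∈P⇒-b≤ P v∈P i) (≤-reflexive (∙-comm (A i) v)))
          (≤-trans (≤-reflexive (∙-comm v (A i))) (v∈P i))
          (solves v (A i) (∈P⇒norm≤1 P v∈P) (dual-norm≤1 P b≤1 i))

        S-S′ : b P i - v ∙ A i - (b P i + - 1# * F) ≈ b P i - A i ∙ v - 𝔼 π v (A i) (λ o → entry o i)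
        S-S′ = +-cong (+-congˡ (-‿cong (∙-comm v (A i))))
          (-‿cong (sym (𝔼-affine v (A i) π (b P i) (- 1#) (decode 0≤ε ε<1 (b P i)))))

      assemble : ∃[ r ] (r ℕ.≤ 2 ℕ.^ c) × HasNonnegFactorization S′ r →
                 log₂⁺ (approxRk⁺ (fromℕ 2 * ε) (slack P)) ≤⁺ [ fromℕ c ]
      assemble (r , r≤ , factor) = log₂-approxRk⁺-≤ S′ c close factor r≤

proposition1p12 : (lem : ExcludedMiddle 0ℓ) (𝓡 : CompleteOrderedField) →
    let open Theory lem 𝓡 in
    (∀ {n M : ℕ} (P : SymmetricPolytope n M) (ε : ℝ) → 0# < ε →
    (∀ i → b P i ≤ 1#) →
    log₂⁺ (approxRk⁺ (fromℕ 2 * ε) (slack P)) ≤⁺ fromℕ⁺ (𝓒 (norm P) ε ε))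
    ×
    (∀ (ε₀ : ℝ) → ε₀ < 1# →
    ∃[ C ] (0# < C) ×
    (∀ {n M : ℕ} (P : SymmetricPolytope n M) (ε : ℝ) → 0# < ε → ε ≤ ε₀ →
    fromℕ⁺ (𝓒 (norm P) ε ε)
    ≤⁺ C * log₂ (ε ⁻¹) *⁺ fromℕ⁺ (𝓒 (norm P) ε (fromℕ 3 ⁻¹))))
proposition1p12 lem 𝓡 = log₂-approxRk⁺-slack , λ ε₀ ε₀<1 → specialise (𝓒-amplification ε₀ ε₀<1)
  where
  open Proof lem 𝓡
  open Theory lem 𝓡

  specialise : ∀ {ε₀} →
    ∃[ C ] (0# < C) × (∀ {n} (N : ℝ^ n → ℝ) (ε : ℝ) → 0# < ε → ε ≤ ε₀ →
      fromℕ⁺ (𝓒 N ε ε) ≤⁺ C * log₂ (ε ⁻¹) *⁺ fromℕ⁺ (𝓒 N ε (fromℕ 3 ⁻¹))) →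
    ∃[ C ] (0# < C) × (∀ {n M} (P : SymmetricPolytope n M) (ε : ℝ) → 0# < ε → ε ≤ ε₀ →
      fromℕ⁺ (𝓒 (norm P) ε ε) ≤⁺ C * log₂ (ε ⁻¹) *⁺ fromℕ⁺ (𝓒 (norm P) ε (fromℕ 3 ⁻¹)))
  specialise (C , 0<C , bound) = C , 0<C , λ P → bound (norm P)
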